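{- For all $r,s\in \mathbb{N}$ and $d,\eta>0$, there exist $\rho,n_0>0$ such that every $(\rho,d)$-dense graph $G$ on $n \geq n_0$ vertices with $\delta(G)\geq (1/2+\eta)n$ contains the $r$th power of a Hamilton cycle. Moreover, for every integer $n'$ with $n-s\leq n' \leq n$, $G$ contains the $r$th power of a cycle covering precisely $n'$ vertices.
   Context: An $n$-vertex graph $G$ is $(\rho,d)$-dense if every $X \subseteq V(G)$ satisfies $e(G[X]) \geq d\binom{|X|}{2}-\rho n^2$. The $r$th power of a cycle $w_1\dots w_k$ is the graph on $\{w_1,\dots,w_k\}$ with edge set $\{w_iw_{i+j}: 1\le i\le k,\ j\in[r]\}$ (indices modulo $k$); equivalently it is obtained from the cycle by joining every pair of vertices at distance at most $r$ on the cycle. A Hamilton cycle is a cycle through all vertices of $G$. -}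

module Defs where

open import Data.Nat as ℕ using (ℕ; zero; suc)
open import Data.Nat.Combinatorics using (_C_)
open import Data.Fin using (Fin; toℕ)
open import Data.List using (List; map; allFin)
open import Data.Nat.ListAction using (sum)
open import Data.Bool using (Bool; true; false; _∧_; if_then_else_)
open import Data.Integer using (+_)
open import Data.Rational using (ℚ; _/_; _+_; _-_; _*_; _≤_; ½)
open import Data.Product using (Σ; ∃; _×_; _,_)
open import Relation.Binary.PropositionalEquality using (_≡_; _≢_)
open import Function.Definitions using (Injective)

record Graph (n : ℕ) : Set where
  field
    adj   : Fin n → Fin n → Bool
    sym   : ∀ u v → adj u v ≡ adj v u
    irref : ∀ v → adj v v ≡ false
open Graph public

ℕ→ℚ : ℕ → ℚ
ℕ→ℚ n = + n / 1

b2n : Bool → ℕ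
b2n true  = 1
b2n false = 0

count : ∀ {n} → (Fin n → Bool) → ℕ
count {n} p = sum (map (λ v → b2n (p v)) (allFin n))

deg : ∀ {n} → Graph n → Fin n → ℕ
deg G v = count (adj G v)

minDeg≥ : ∀ {n} → Graph n → ℚ → Set
minDeg≥ {n} G c = ∀ v → c * ℕ→ℚ n ≤ ℕ→ℚ (deg G v)

eIn : ∀ {n} → Graph n → (Fin n → Bool) → ℕ
eIn {n} G X =
  sum (map (λ u → count (λ v →
        (toℕ u ℕ.<ᵇ toℕ v) ∧ X u ∧ X v ∧ adj G u v)) (allFin n))

Dense : ∀ {n} → ℚ → ℚ → Graph n → Set
Dense {n} ρ d G = ∀ (X : Fin n → Bool) →
  d * ℕ→ℚ (count X C 2) - ρ * ℕ→ℚ (n ℕ.* n) ≤ ℕ→ℚ (eIn G X)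

CycStep : ∀ {k} → Fin k → ℕ → Fin k → Set
CycStep {k} i j l = ∃ λ q → toℕ i ℕ.+ j ≡ toℕ l ℕ.+ q ℕ.* k

HasCyclePower : ∀ {n} → Graph n → ℕ → ℕ → Set
HasCyclePower {n} G r k =
  Σ (Fin k → Fin n) λ w → Injective _≡_ _≡_ w ×
    (∀ (i l : Fin k) (j : ℕ) → 1 ℕ.≤ j → j ℕ.≤ r → CycStep i j l →
       i ≢ l → adj G (w i) (w l) ≡ true)

HasHamCyclePower : ∀ {n} → Graph n → ℕ → Set
HasHamCyclePower {n} G r = HasCyclePower G r n

{-# OPTIONS --safe #-}
-- Local density enters only through the fact that every set of linearly many vertices contains
-- large cliques.  Partition the vertices greedily into cliques of a large constant size m until fewer
-- than n/m vertices are left.  In each clique fix a small core; all other vertices may be moved.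
-- The movable part of the neighbourhood of a left-over vertex w is linear in n, so it contains a
-- clique, which together with w is a further clique of the partition.  Two cores are connected as
-- follows: by the degree condition a linear number of movable vertices have at least r neighbours in
-- both cores, linearly many of these have the same neighbours there, and among them there is a
-- K_r.  Linking the cliques cyclically in this way cuts the vertex set into a cyclic sequence of
-- blocks of size at least r such that any two consecutive blocks form a clique, and
-- listing the blocks in order gives the r-th power of a cycle.
module Submission where

open import Defs renaming (sym to adj-sym)
open import Data.Nat as ℕ using (ℕ; zero; suc; NonZero; z≤n; s≤s)
import Data.Nat.Properties as ℕ
open import Data.Nat.Combinatorics using (_C_; nC1≡n; nCk+nC[k+1]≡[n+1]C[k+1])
open import Data.Nat.DivMod using (_/_; _%_; m≡m%n+[m/n]*n; m%n<n; [m+kn]%n≡m%n; m<n⇒m%n≡m; m<n*o⇒m/o<n)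
import Data.Nat.ListAction as ListAction
open import Data.Nat.Tactic.RingSolver using (solve-∀)
import Data.Integer as ℤ
import Data.Integer.Properties as ℤ
open import Data.Rational as ℚ using (ℚ; mkℚ; 0ℚ; 1ℚ; ½; 1/_; Positive; toℚᵘ)
import Data.Rational.Properties as ℚ
open import Data.Rational.Solver using (module +-*-Solver)
open import Data.Rational.Unnormalised as ℚᵘ using (mkℚᵘ; *≡*; *≤*) renaming (_≃_ to _≃ᵘ_)
import Data.Rational.Unnormalised.Properties as ℚᵘ
open import Data.Bool as Bool using (Bool; true; false; _∧_; not; if_then_else_)
open import Data.Maybe using (Maybe; just; nothing)
open import Data.Maybe.Properties using (just-injective)
open import Data.Fin as Fin using (Fin; toℕ; fromℕ<; inject≤)
import Data.Fin.Properties as Fin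
open import Data.List using (List; []; _∷_; _++_; [_]; length; lookup; map; allFin; tabulate; filter)
open import Data.List.Properties using (length-filter; length-++; length-map; length-tabulate)
open import Data.List.Membership.Propositional using (_∈_; _∉_)
open import Data.List.Membership.Propositional.Properties using (∈-lookup; ∈-++⁺ˡ; ∈-++⁺ʳ; ∈-filter⁻; ∈-map⁺; ∈-map⁻; ∈-allFin)
open import Data.List.Relation.Unary.All as All using (All; []; _∷_)
import Data.List.Relation.Unary.All.Properties as All
open import Data.List.Relation.Unary.AllPairs as AllPairs using (AllPairs; []; _∷_)
import Data.List.Relation.Unary.AllPairs.Properties as AllPairs
open import Data.List.Relation.Unary.Any as Any using (here; there)
open import Data.List.Relation.Unary.Any.Properties using (lookup-index)
open import Data.List.Relation.Unary.Sorted.TotalOrder.Properties using (lookup-mono-≤)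
open import Data.List.Relation.Unary.Unique.Propositional using (Unique)
import Data.List.Relation.Unary.Unique.Propositional.Properties as Unique
open import Data.List.Relation.Binary.Permutation.Propositional using (_↭_; ↭-sym; ↭⇒↭ₛ)
open import Data.List.Relation.Binary.Permutation.Propositional.Properties using (↭-length; ∈-resp-↭)
import Data.List.Relation.Binary.Permutation.Setoid.Properties as SetoidPerm
import Data.List.Sort as Sort
open import Data.Product using (Σ; ∃; _×_; _,_; proj₁; proj₂)
open import Data.Sum using (_⊎_; inj₁; inj₂)
open import Function using (_∘_; id; case_of_; const)
open import Function.Definitions using (Injective)
open import Relation.Binary.Bundles using (DecTotalOrder)
import Relation.Binary.Construct.On as On
open import Relation.Binary.Definitions using (tri<; tri≈; tri>)
open import Relation.Binary.PropositionalEquality hiding ([_])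
open import Relation.Nullary using (Dec; yes; no; does; contradiction; _×-dec_)
open import Relation.Nullary.Decidable using (map′; _→-dec_; dec-true; dec-false)

-- Counting shapes the proof. After the greedy stage every choice is made among free vertices, so
-- those that are not free must stay below n/(2h), where 1/h ≤ η. A clique fixes its core, and its
-- connector fixes r more vertices. Hence m = 8hK with K just above `core + r`: there are at most
-- 2n/m = n/(4hK) cliques, those made for left-over vertices included, and the other n/(4h) pays for
-- the at most s vertices kept off the cycle. The latter are only labelled, never deleted, so
-- density and degrees always refer to G on all n vertices.
--
-- The core size on either side is c = hr, since averaging the degree surplus n/h over c core
-- vertices then yields r common neighbours. A connector sees only part of a core, so each clique is
-- cut into three blocks: the `inn` vertices joined to the connector before it, the `out` vertices
-- joined to the connector after it, and all the rest between them. The r vertices `mid` are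
-- reserved so that this middle block cannot be too small.

module _ where

  open import Data.Nat using (_+_; _*_; _∸_; _^_; _≤_; _<_; _≤?_; _<?_; _≤ᵇ_)
  open import Data.Nat.Properties

  -- Cyclic arrangement of blocks

  lookup-AllPairs : ∀ {A : Set} {R : A → A → Set} {xs} → AllPairs R xs →
                    ∀ {i j} → i Fin.< j → R (lookup xs i) (lookup xs j)
  lookup-AllPairs (px ∷ _)  {Fin.zero}  {Fin.suc j} _         = All.lookup px (∈-lookup j)
  lookup-AllPairs (_  ∷ ps) {Fin.suc i} {Fin.suc j} (s≤s i<j) = lookup-AllPairs ps i<j

  lookup-injective : ∀ {A : Set} {xs : List A} → Unique xs → Injective _≡_ _≡_ (lookup xs)
  lookup-injective u {i} {j} eq with Fin.<-cmp i j
  ... | tri< i<j _ _ = contradiction eq (lookup-AllPairs u i<j)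
  ... | tri≈ _ i≡j _ = i≡j
  ... | tri> _ _ j<i = contradiction (sym eq) (lookup-AllPairs u j<i)

  -- The cyclic order is obtained by sorting with the block number as key; the order inside a block
  -- never matters.
  sortedEnumeration : ∀ {A : Set} (g : A → ℕ) (L : List A) → Unique L → ∀ {k} → length L ≡ k →
    Σ (Fin k → A) λ w → Injective _≡_ _≡_ w × (∀ p → w p ∈ L) ×
      (∀ {v} → v ∈ L → ∃ λ p → w p ≡ v) ×
      (∀ {p q} → p Fin.≤ q → g (w p) ≤ g (w q))
  sortedEnumeration {A} g L u refl = enum (↭-length perm)
    where
    open Sort (On.decTotalOrder ≤-decTotalOrder g)
    M = sort L
    perm : M ↭ L
    perm = sort-↭ L
    uM : Unique M
    uM = SetoidPerm.Unique-resp-↭ (setoid A) (↭⇒↭ₛ (↭-sym perm)) u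
    enum : ∀ {k} → length M ≡ k → Σ (Fin k → A) λ w → Injective _≡_ _≡_ w × (∀ p → w p ∈ L) ×
      (∀ {v} → v ∈ L → ∃ λ p → w p ≡ v) × (∀ {p q} → p Fin.≤ q → g (w p) ≤ g (w q))
    enum refl = lookup M , lookup-injective uM , (λ p → ∈-resp-↭ perm (∈-lookup p)) ,
      (λ v∈L → let v∈M = ∈-resp-↭ (↭-sym perm) v∈L in Any.index v∈M , sym (lookup-index v∈M)) ,
      lookup-mono-≤ (DecTotalOrder.totalOrder (On.decTotalOrder ≤-decTotalOrder g)) (sort-↗ L)

  interval-pigeonhole : ∀ {r lo hi} (y : Fin r → ℕ) → Injective _≡_ _≡_ y →
    (∀ a → lo ≤ y a × y a < hi) → r ≤ hi ∸ lo
  interval-pigeonhole {r} {lo} {hi} y inj bd with r ≤? hi ∸ lo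
  ... | yes r≤ = r≤
  ... | no r≰ with Fin.pigeonhole (≰⇒> r≰) (λ a → fromℕ< (∸-monoˡ-< (proj₂ (bd a)) (proj₁ (bd a))))
  ...   | a , b , a<b , eq = contradiction (inj (∸-cancelʳ-≡ (proj₁ (bd a)) (proj₁ (bd b))
            (Fin.fromℕ<-injective _ _ _ _ eq))) (Fin.<⇒≢ a<b)

  Consecutive : ℕ → ℕ → ℕ → Set
  Consecutive T b b′ = (b ≡ b′) ⊎ (suc b ≡ b′) ⊎ (suc b ≡ T × b′ ≡ 0)

  -- Two vertices at cyclic distance at most r lie in consecutive blocks, as a block between them
  -- would need r places strictly between them.
  cyclePower-from-blocks : ∀ {n} (G : Graph n) (r k T : ℕ) → r < k →
    (L : List (Fin n)) → Unique L → length L ≡ k → (g : Fin n → ℕ) →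
    (∀ {v} → v ∈ L → g v < T) →
    (∀ {b} → b < T → Σ (List (Fin n)) λ B → Unique B × r ≤ length B × All (λ v → v ∈ L × g v ≡ b) B) →
    (∀ {u v} → u ∈ L → v ∈ L → u ≢ v → Consecutive T (g u) (g v) → adj G u v ≡ true) →
    HasCyclePower G r k
  cyclePower-from-blocks {n} G r k T r<k L uL len g g<T block join
    with sortedEnumeration g L uL len
  ... | w , w-inj , w∈L , pos , mono = w , w-inj , edge
    where
    between : ∀ {b} → b < T → ∀ lo hi →
      (∀ p → g (w p) ≡ b → lo ≤ toℕ p × toℕ p < hi) → r ≤ hi ∸ lo
    between b<T lo hi bd with block b<T
    ... | B , uB , r≤ , all = interval-pigeonhole (toℕ ∘ y) y-inj (λ a → bd (y a) (y-blk a))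
      where
      el : Fin r → Fin n
      el a = lookup B (inject≤ a r≤)
      place : ∀ a → ∃ λ p → w p ≡ el a
      place a = pos (proj₁ (All.lookup all (∈-lookup (inject≤ a r≤))))
      y : Fin r → Fin k
      y a = proj₁ (place a)
      y-blk : ∀ a → g (w (y a)) ≡ _
      y-blk a = trans (cong g (proj₂ (place a))) (proj₂ (All.lookup all (∈-lookup (inject≤ a r≤))))
      y-inj : Injective _≡_ _≡_ (toℕ ∘ y)
      y-inj {a} {b} eq = Fin.inject≤-injective r≤ r≤ a b (lookup-injective uB
        (trans (sym (proj₂ (place a))) (trans (cong w (Fin.toℕ-injective eq)) (proj₂ (place b)))))

    after : ∀ {i p} → g (w i) < g (w p) → toℕ i < toℕ p
    after lt = ≰⇒> λ p≤i → <⇒≱ lt (mono p≤i)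

    consecutive : ∀ (i l : Fin k) j → 1 ≤ j → j ≤ r → CycStep i j l → Consecutive T (g (w i)) (g (w l))
    consecutive i l j 1≤j j≤r (0 , eq) with <-cmp (g (w i)) (g (w l))
    ... | tri≈ _ b≡ _ = inj₁ b≡
    ... | tri> _ _ b> = contradiction (after b>) (≤⇒≯ (≤-trans (m≤m+n (toℕ i) j) (≤-reflexive (trans eq (+-identityʳ _)))))
    ... | tri< b< _ _ with m≤n⇒m<n∨m≡n b<
    ...   | inj₂ sb≡ = inj₂ (inj₁ sb≡)
    ...   | inj₁ sb< = contradiction fits (<⇒≱ (≤-trans short j≤r))
      where
      fits : r ≤ toℕ l ∸ suc (toℕ i)
      fits = between (<-trans sb< (g<T (w∈L l))) (suc (toℕ i)) (toℕ l) λ p e →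
        after (subst (g (w i) <_) (sym e) ≤-refl) , after (subst (_< g (w l)) (sym e) sb<)
      short : suc (toℕ l ∸ suc (toℕ i)) ≤ j
      short = ≤-reflexive (begin
        suc (toℕ l ∸ suc (toℕ i))      ≡⟨ sym (+-∸-assoc 1 (after b<)) ⟩
        toℕ l ∸ toℕ i                  ≡⟨ cong (_∸ toℕ i) (sym (trans eq (+-identityʳ _))) ⟩
        (toℕ i + j) ∸ toℕ i            ≡⟨ m+n∸m≡n (toℕ i) j ⟩
        j ∎)
        where open ≡-Reasoning
    -- The step passes the end of the enumeration once. A block after that of `i` would need its r
    -- places among the k - i - 1 places past `i`, and a block before that of `l` among the l places
    -- preceding it; both numbers are below j ≤ r.
    consecutive i l j 1≤j j≤r (1 , eq) = inj₂ (inj₂ (last , first))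
      where
      eq′ : toℕ i + j ≡ toℕ l + k
      eq′ = trans eq (cong (toℕ l +_) (+-identityʳ k))
      last : suc (g (w i)) ≡ T
      last with m≤n⇒m<n∨m≡n (g<T (w∈L i))
      ... | inj₂ e = e
      ... | inj₁ sb<T = contradiction fits (<⇒≱ (≤-trans short j≤r))
        where
        fits : r ≤ k ∸ suc (toℕ i)
        fits = between sb<T (suc (toℕ i)) k λ p e →
          after (subst (g (w i) <_) (sym e) ≤-refl) , Fin.toℕ<n p
        short : suc (k ∸ suc (toℕ i)) ≤ j
        short = begin
          suc (k ∸ suc (toℕ i))   ≡⟨ sym (+-∸-assoc 1 (Fin.toℕ<n i)) ⟩
          k ∸ toℕ i               ≤⟨ ∸-monoˡ-≤ (toℕ i) (≤-trans (m≤n+m k (toℕ l)) (≤-reflexive (sym eq′))) ⟩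
          (toℕ i + j) ∸ toℕ i     ≡⟨ m+n∸m≡n (toℕ i) j ⟩
          j ∎
          where open ≤-Reasoning
      short : toℕ l < j
      short = +-cancelˡ-< k _ _ (begin-strict
        k + toℕ l ≡⟨ +-comm k _ ⟩
        toℕ l + k ≡⟨ sym eq′ ⟩
        toℕ i + j <⟨ +-monoˡ-< j (Fin.toℕ<n i) ⟩
        k + j ∎)
        where open ≤-Reasoning
      first : g (w l) ≡ 0
      first with g (w l) in e
      ... | 0 = refl
      ... | suc b = contradiction (between (<-trans (≤-reflexive (sym e)) (g<T (w∈L l))) 0 (toℕ l) λ p e′ →
              z≤n , after (≤-reflexive (trans (cong suc e′) (sym e)))) (<⇒≱ (≤-trans short j≤r))
    -- A step of length at most r < k cannot go round twice.
    consecutive i l j 1≤j j≤r (suc (suc q) , eq) = contradiction eq (<⇒≢ (begin-strict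
      toℕ i + j              <⟨ +-mono-<-≤ (Fin.toℕ<n i) (≤-trans j≤r (<⇒≤ r<k)) ⟩
      k + k                  ≤⟨ +-monoʳ-≤ k (m≤m+n k (q * k)) ⟩
      k + (k + q * k)        ≤⟨ m≤n+m _ (toℕ l) ⟩
      toℕ l + (k + (k + q * k)) ∎))
      where open ≤-Reasoning

    edge : ∀ i l j → 1 ≤ j → j ≤ r → CycStep i j l → i ≢ l → adj G (w i) (w l) ≡ true
    edge i l j 1≤j j≤r step i≢l =
      join (w∈L i) (w∈L l) (i≢l ∘ w-inj) (consecutive i l j 1≤j j≤r step)

  -- Cardinalities

  abstract
    ∑ : ∀ {n} → (Fin n → ℕ) → ℕ
    ∑ {zero}  f = 0
    ∑ {suc n} f = f Fin.zero + ∑ (f ∘ Fin.suc)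

    ∑-cong : ∀ {n} {f g : Fin n → ℕ} → (∀ i → f i ≡ g i) → ∑ f ≡ ∑ g
    ∑-cong {zero}  f≡g = refl
    ∑-cong {suc n} f≡g = cong₂ _+_ (f≡g Fin.zero) (∑-cong (f≡g ∘ Fin.suc))

    ∑-distrib-+ : ∀ {n} (f g : Fin n → ℕ) → ∑ (λ i → f i + g i) ≡ ∑ f + ∑ g
    ∑-distrib-+ {zero}  f g = refl
    ∑-distrib-+ {suc n} f g = trans (cong (f Fin.zero + g Fin.zero +_) (∑-distrib-+ (f ∘ Fin.suc) (g ∘ Fin.suc)))
      (interchange (f Fin.zero) (g Fin.zero) _ _)
      where
      interchange : ∀ a b c d → a + b + (c + d) ≡ a + c + (b + d)
      interchange = solve-∀

    ∑-mono-≤ : ∀ {n} {f g : Fin n → ℕ} → (∀ i → f i ≤ g i) → ∑ f ≤ ∑ g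
    ∑-mono-≤ {zero}  f≤g = z≤n
    ∑-mono-≤ {suc n} f≤g = +-mono-≤ (f≤g Fin.zero) (∑-mono-≤ (f≤g ∘ Fin.suc))

    *-distribˡ-∑ : ∀ {n} k (f : Fin n → ℕ) → k * ∑ f ≡ ∑ (λ i → k * f i)
    *-distribˡ-∑ {zero}  k f = *-zeroʳ k
    *-distribˡ-∑ {suc n} k f = trans (*-distribˡ-+ k (f Fin.zero) _)
      (cong (k * f Fin.zero +_) (*-distribˡ-∑ k (f ∘ Fin.suc)))

    ∑-const : ∀ n k → ∑ {n} (λ _ → k) ≡ n * k
    ∑-const zero    k = refl
    ∑-const (suc n) k = cong (k +_) (∑-const n k)

    sum-map-tabulate : ∀ {n m} (f : Fin m → ℕ) (g : Fin n → Fin m) →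
                       ListAction.sum (map f (tabulate g)) ≡ ∑ (f ∘ g)
    sum-map-tabulate {zero}  f g = refl
    sum-map-tabulate {suc n} f g = cong (f (g Fin.zero) +_) (sum-map-tabulate f (g ∘ Fin.suc))

  card : ∀ {n} → (Fin n → Bool) → ℕ
  card p = ∑ (b2n ∘ p)

  count≡card : ∀ {n} (p : Fin n → Bool) → count p ≡ card p
  count≡card p = sum-map-tabulate (b2n ∘ p) id

  b2n≤1 : ∀ b → b2n b ≤ 1
  b2n≤1 true  = s≤s z≤n
  b2n≤1 false = z≤n

  card≤n : ∀ {n} (p : Fin n → Bool) → card p ≤ n
  card≤n {n} p = ≤-trans (∑-mono-≤ (b2n≤1 ∘ p)) (≤-reflexive (trans (∑-const n 1) (*-identityʳ n)))

  card-mono : ∀ {n} {p q : Fin n → Bool} → (∀ v → p v ≡ true → q v ≡ true) → card p ≤ card q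
  card-mono {p = p} {q} p⊆q = ∑-mono-≤ λ v → pointwise v (p v) refl
    where
    pointwise : ∀ v b → p v ≡ b → b2n b ≤ b2n (q v)
    pointwise v true  eq rewrite p⊆q v eq = ≤-refl
    pointwise v false eq = z≤n

  card-cover : ∀ {n} {p q s : Fin n → Bool} →
    (∀ v → p v ≡ true → q v ≡ true ⊎ s v ≡ true) → card p ≤ card q + card s
  card-cover {p = p} {q} {s} cover = ≤-trans (∑-mono-≤ λ v → pointwise v (p v) refl)
    (≤-reflexive (∑-distrib-+ (b2n ∘ q) (b2n ∘ s)))
    where
    pointwise : ∀ v b → p v ≡ b → b2n b ≤ b2n (q v) + b2n (s v)
    pointwise v false eq = z≤n
    pointwise v true  eq with cover v eq
    ... | inj₁ qv rewrite qv = s≤s z≤n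
    ... | inj₂ sv rewrite sv = m≤n+m 1 (b2n (q v))

  card-pack : ∀ {n} {p q s : Fin n → Bool} → (∀ v → q v ≡ true → p v ≡ true) →
    (∀ v → s v ≡ true → p v ≡ true × q v ≡ false) → card q + card s ≤ card p
  card-pack {p = p} {q} {s} q⊆p s⊆p∖q = ≤-trans (≤-reflexive (sym (∑-distrib-+ (b2n ∘ q) (b2n ∘ s))))
    (∑-mono-≤ λ v → pointwise v (q v) (s v) refl refl)
    where
    pointwise : ∀ v b b′ → q v ≡ b → s v ≡ b′ → b2n b + b2n b′ ≤ b2n (p v)
    pointwise v b true qv sv with s⊆p∖q v sv
    ... | pv , qv′ rewrite pv | trans (sym qv) qv′ = ≤-refl
    pointwise v true  false qv sv rewrite q⊆p v qv = ≤-refl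
    pointwise v false false qv sv = z≤n

  abstract
    card-empty : ∀ {n} {p : Fin n → Bool} → card p ≡ 0 → ∀ v → p v ≡ false
    card-empty {suc n} {p} eq v with p Fin.zero in p0
    card-empty {suc n} {p} eq Fin.zero    | false = p0
    card-empty {suc n} {p} eq (Fin.suc v) | false = card-empty eq v

    card-inhabited : ∀ {n} {p : Fin n → Bool} → 0 < card p → ∃ λ v → p v ≡ true
    card-inhabited {suc n} {p} lt with p Fin.zero in p0
    ... | true  = Fin.zero , p0
    ... | false with card-inhabited lt
    ...   | v , pv = Fin.suc v , pv

  elem : ∀ {n} → List (Fin n) → Fin n → Bool
  elem []       v = false
  elem (x ∷ xs) v = if does (v Fin.≟ x) then true else elem xs v

  ∈⇒elem : ∀ {n} {v : Fin n} {L} → v ∈ L → elem L v ≡ true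
  ∈⇒elem {v = v} {x ∷ xs} v∈ with v Fin.≟ x
  ... | yes _ = refl
  ... | no v≢x with v∈
  ...   | here v≡x  = contradiction v≡x v≢x
  ...   | there v∈′ = ∈⇒elem v∈′

  elem⇒∈ : ∀ {n} {v : Fin n} {L} → elem L v ≡ true → v ∈ L
  elem⇒∈ {v = v} {x ∷ xs} eq with v Fin.≟ x
  ... | yes v≡x = here v≡x
  ... | no  _   = there (elem⇒∈ eq)

  ∉⇒elem : ∀ {n} {v : Fin n} {L} → v ∉ L → elem L v ≡ false
  ∉⇒elem {v = v} {L} v∉ with elem L v in eq
  ... | false = refl
  ... | true  = contradiction (elem⇒∈ eq) v∉

  abstract
    card-singleton : ∀ {n} (x : Fin n) → card (λ v → does (v Fin.≟ x)) ≡ 1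
    card-singleton {suc n} Fin.zero = cong suc (trans (∑-const n 0) (*-zeroʳ n))
    card-singleton {suc n} (Fin.suc x) = trans (∑-cong {n} λ v → cong b2n (does-suc v)) (card-singleton x)
      where
      does-suc : ∀ v → does (Fin.suc v Fin.≟ Fin.suc x) ≡ does (v Fin.≟ x)
      does-suc v with v Fin.≟ x
      ... | yes _ = refl
      ... | no  _ = refl

  card-elem-≤ : ∀ {n} (L : List (Fin n)) → card (elem L) ≤ length L
  card-elem-≤ {n} [] = ≤-reflexive (trans (∑-const n 0) (*-zeroʳ n))
  card-elem-≤ (x ∷ xs) = ≤-trans (card-cover cover) (+-mono-≤ (≤-reflexive (card-singleton x)) (card-elem-≤ xs))
    where
    cover : ∀ v → elem (x ∷ xs) v ≡ true → does (v Fin.≟ x) ≡ true ⊎ elem xs v ≡ true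
    cover v eq with v Fin.≟ x
    ... | yes _ = inj₁ refl
    ... | no  _ = inj₂ eq

  card-elem-≥ : ∀ {n} {L : List (Fin n)} → Unique L → length L ≤ card (elem L)
  card-elem-≥ {L = []} u = z≤n
  card-elem-≥ {L = x ∷ xs} (x∉ ∷ u) = begin
    1 + length xs                                   ≡⟨ +-comm 1 _ ⟩
    length xs + 1                                   ≤⟨ +-mono-≤ (card-elem-≥ u) (≤-reflexive (sym (card-singleton x))) ⟩
    card (elem xs) + card (λ v → does (v Fin.≟ x))  ≤⟨ card-pack (λ v → sub v) own ⟩
    card (elem (x ∷ xs)) ∎
    where
    open ≤-Reasoning
    sub : ∀ v → elem xs v ≡ true → elem (x ∷ xs) v ≡ true
    sub v eq with v Fin.≟ x
    ... | yes _ = refl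
    ... | no  _ = eq
    own : ∀ v → does (v Fin.≟ x) ≡ true → elem (x ∷ xs) v ≡ true × elem xs v ≡ false
    own v eq with v Fin.≟ x
    ... | yes refl = refl , ∉⇒elem (λ v∈ → All.lookup x∉ v∈ refl)

  -- Cliques in locally dense graphs

  ∧-trueˡ : ∀ a {b} → a ∧ b ≡ true → a ≡ true
  ∧-trueˡ true _ = refl

  ∧-trueʳ : ∀ a {b} → a ∧ b ≡ true → b ≡ true
  ∧-trueʳ true eq = eq

  Clique : ∀ {n} → Graph n → List (Fin n) → Set
  Clique G = AllPairs (λ u v → adj G u v ≡ true)

  -- This is (1/(DP), 1/D)-density with the denominators cleared.
  LocallyDense : ∀ {n} → ℕ → ℕ → Graph n → Set
  LocallyDense {n} D P G = ∀ X → P * (card X C 2) ≤ D * P * eIn G X + n * n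

  degIn : ∀ {n} → Graph n → (Fin n → Bool) → Fin n → ℕ
  degIn G X u = card (λ v → X v ∧ adj G u v)

  -- The right side counts each edge twice; this factor 2 is given away.
  eIn≤∑degIn : ∀ {n} (G : Graph n) X → eIn G X ≤ ∑ (λ u → b2n (X u) * degIn G X u)
  eIn≤∑degIn {n} G X = ≤-trans (≤-reflexive (sum-map-tabulate _ id)) (∑-mono-≤ row)
    where
    row : ∀ u → count (λ v → (toℕ u ℕ.<ᵇ toℕ v) ∧ X u ∧ X v ∧ adj G u v) ≤ b2n (X u) * degIn G X u
    row u = ≤-trans (≤-reflexive (count≡card _)) (case-X (X u))
      where
      case-X : ∀ b → card (λ v → (toℕ u ℕ.<ᵇ toℕ v) ∧ b ∧ X v ∧ adj G u v) ≤ b2n b * degIn G X u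
      case-X true = ≤-trans (card-mono drop<) (m≤m+n _ 0)
        where
        drop< : ∀ v → (toℕ u ℕ.<ᵇ toℕ v) ∧ X v ∧ adj G u v ≡ true → X v ∧ adj G u v ≡ true
        drop< v eq with toℕ u ℕ.<ᵇ toℕ v
        ... | true = eq
      case-X false = ≤-trans (card-mono {q = λ _ → false} none) (≤-reflexive (trans (∑-const n 0) (*-zeroʳ n)))
        where
        none : ∀ v → (toℕ u ℕ.<ᵇ toℕ v) ∧ false ≡ true → false ≡ true
        none v eq with toℕ u ℕ.<ᵇ toℕ v
        ... | true  = eq
        ... | false = eq

  2*nC2+n≡n*n : ∀ n → 2 * (n C 2) + n ≡ n * n
  2*nC2+n≡n*n zero = refl
  2*nC2+n≡n*n (suc n) = begin
    2 * (suc n C 2) + suc n        ≡⟨ cong (λ z → 2 * z + suc n) (sym (nCk+nC[k+1]≡[n+1]C[k+1] n 1)) ⟩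
    2 * (n C 1 + n C 2) + suc n    ≡⟨ cong (λ z → 2 * (z + n C 2) + suc n) (nC1≡n n) ⟩
    2 * (n + n C 2) + suc n        ≡⟨ rearrange n (n C 2) ⟩
    (2 * (n C 2) + n) + (2 * n + 1) ≡⟨ cong (_+ (2 * n + 1)) (2*nC2+n≡n*n n) ⟩
    n * n + (2 * n + 1)            ≡⟨ square n ⟩
    suc n * suc n ∎
    where
    open ≡-Reasoning
    rearrange : ∀ n c → 2 * (n + c) + suc n ≡ (2 * c + n) + (2 * n + 1)
    rearrange = solve-∀
    square : ∀ n → n * n + (2 * n + 1) ≡ suc n * suc n
    square = solve-∀

  -- Here `p` stands for x choose 2 and `e` for the edges in a set of x vertices. Density demands
  -- (x² - x)/(2D) edges up to an error n²/(DP), which is at most x²/(8D) because P = 8F² and n ≤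
  -- Fx. With only x²/(4D) edges present, x²/(8D) must be made up by the lower-order term x/(2D).
  few-edges-small : ∀ {n D e p x} F .{{_ : NonZero F}} → 8 * (F * F) * p ≤ D * (8 * (F * F)) * e + n * n →
    4 * D * e ≤ x * x → 2 * p + x ≡ x * x → n ≤ F * x → x ≤ 4
  few-edges-small {n} {D} {e} {p} {zero} F dense few choose n≤ = z≤n
  few-edges-small {n} {D} {e} {p} {x@(suc _)} F dense few choose n≤ =
    *-cancelʳ-≤ x 4 x (*-cancelˡ-≤ P (+-cancelˡ-≤ (3 * P * (x * x)) _ _ (begin
      3 * P * (x * x) + P * (x * x)                      ≡⟨ s₁ P (x * x) ⟩
      4 * P * (x * x)                                    ≡⟨ cong (4 * P *_) (sym choose) ⟩
      4 * P * (2 * p + x)                                ≡⟨ s₂ P p x ⟩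
      8 * (P * p) + P * (4 * x)                          ≤⟨ +-monoˡ-≤ (P * (4 * x)) (*-monoʳ-≤ 8 dense) ⟩
      8 * (D * P * e + n * n) + P * (4 * x)              ≡⟨ cong (_+ P * (4 * x)) (s₃ D P e (n * n)) ⟩
      2 * P * (4 * D * e) + 8 * (n * n) + P * (4 * x)    ≤⟨ +-monoˡ-≤ (P * (4 * x)) (+-mono-≤ (*-monoʳ-≤ (2 * P) few) (*-monoʳ-≤ 8 (*-mono-≤ n≤ n≤))) ⟩
      2 * P * (x * x) + 8 * (F * x * (F * x)) + P * (4 * x) ≡⟨ cong (_+ P * (4 * x)) (s₄ F x) ⟩
      3 * P * (x * x) + P * (4 * x) ∎)))
    where
    open ≤-Reasoning
    P = 8 * (F * F)
    instance
      P≢0 : NonZero P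
      P≢0 = m*n≢0 8 (F * F) {{_}} {{m*n≢0 F F}}
    s₁ : ∀ P y → 3 * P * y + P * y ≡ 4 * P * y
    s₁ = solve-∀
    s₂ : ∀ P p x → 4 * P * (2 * p + x) ≡ 8 * (P * p) + P * (4 * x)
    s₂ = solve-∀
    s₃ : ∀ D P e y → 8 * (D * P * e + y) ≡ 2 * P * (4 * D * e) + 8 * y
    s₃ = solve-∀
    s₄ : ∀ F x → 2 * (8 * (F * F)) * (x * x) + 8 * (F * x * (F * x)) ≡ 3 * (8 * (F * F)) * (x * x)
    s₄ = solve-∀

  module _ {n} (G : Graph n) (D F : ℕ) .{{_ : NonZero D}} .{{_ : NonZero F}}
           (dense : LocallyDense D (8 * (F * F)) G) (5F≤n : 5 * F ≤ n) where

    -- Otherwise the degrees inside X sum to at most |X|²/(4D), too few for local density; 5F ≤ n ≤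
    -- F|X| excludes the small sets that `few-edges-small` permits.
    high-degree-vertex : ∀ X → n ≤ F * card X → ∃ λ u → X u ≡ true × card X ≤ 4 * D * degIn G X u
    high-degree-vertex X n≤ with Fin.any? (λ u → (X u Bool.≟ true) ×-dec (card X ≤? 4 * D * degIn G X u))
    ... | yes found = found
    ... | no none = contradiction
            (few-edges-small {D = D} {e = eIn G X} F (dense X) few (2*nC2+n≡n*n (card X)) n≤) (<⇒≱ 5≤x)
      where
      open ≤-Reasoning
      x = card X
      5≤x : 5 ≤ x
      5≤x = *-cancelˡ-≤ F (≤-trans (≤-reflexive (*-comm F 5)) (≤-trans 5F≤n n≤))
      low : ∀ u → 4 * D * (b2n (X u) * degIn G X u) ≤ x * b2n (X u)
      low u with X u in Xu
      ... | false = ≤-trans (≤-reflexive (*-zeroʳ (4 * D))) z≤n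
      ... | true  = begin
        4 * D * (1 * degIn G X u) ≡⟨ cong (4 * D *_) (*-identityˡ _) ⟩
        4 * D * degIn G X u       ≤⟨ <⇒≤ (≰⇒> λ big → none (u , Xu , big)) ⟩
        x                         ≡⟨ sym (*-identityʳ x) ⟩
        x * 1 ∎
      few : 4 * D * eIn G X ≤ x * x
      few = begin
        4 * D * eIn G X                               ≤⟨ *-monoʳ-≤ (4 * D) (eIn≤∑degIn G X) ⟩
        4 * D * ∑ (λ u → b2n (X u) * degIn G X u)     ≡⟨ *-distribˡ-∑ (4 * D) _ ⟩
        ∑ (λ u → 4 * D * (b2n (X u) * degIn G X u))   ≤⟨ ∑-mono-≤ low ⟩
        ∑ (λ u → x * b2n (X u))                       ≡⟨ sym (*-distribˡ-∑ x _) ⟩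
        x * x ∎

    -- Greedy: choose a vertex of high degree in X and continue inside its neighbourhood. Each round
    -- costs a factor 4D in size, and the bound by F keeps every set met on the way large enough for
    -- `high-degree-vertex`.
    clique-in : ∀ k E X → E * (4 * D) ^ k ≤ F → n ≤ E * card X →
      Σ (List (Fin n)) λ L → length L ≡ k × Clique G L × All (λ v → X v ≡ true) L
    clique-in zero    E X E≤F n≤ = [] , refl , [] , []
    clique-in (suc k) E X E≤F n≤ with high-degree-vertex X (≤-trans n≤ (*-monoˡ-≤ (card X) (≤-trans (m≤m*n E _) E≤F)))
      where instance
        4D≢0 : NonZero (4 * D)
        4D≢0 = m*n≢0 4 D
        pow≢0 : NonZero ((4 * D) ^ suc k)
        pow≢0 = m^n≢0 (4 * D) (suc k)
    ... | u , Xu , high with clique-in k (E * (4 * D)) (λ v → X v ∧ adj G u v)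
                              (≤-trans (≤-reflexive (*-assoc E (4 * D) _)) E≤F)
                              (≤-trans n≤ (≤-trans (*-monoʳ-≤ E high) (≤-reflexive (sym (*-assoc E (4 * D) _)))))
    ...   | L , len , clq , L⊆ = u ∷ L , cong suc len , All.map (λ {v} → ∧-trueʳ (X v)) L⊆ ∷ clq ,
                                  Xu ∷ All.map (λ {v} → ∧-trueˡ (X v)) L⊆

  -- Connecting two cliques

  CliqueRich : ∀ {n} → ℕ → ℕ → Graph n → Set
  CliqueRich {n} E m G = ∀ X k → k ≤ m → n ≤ E * card X →
    Σ (List (Fin n)) λ L → length L ≡ k × Clique G L × All (λ v → X v ≡ true) L

  locallyDense⇒cliqueRich : ∀ {n} (G : Graph n) D E m .{{_ : NonZero D}} .{{_ : NonZero E}} →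
    let F = E * (4 * D) ^ m in LocallyDense D (8 * (F * F)) G → 5 * F ≤ n → CliqueRich E m G
  locallyDense⇒cliqueRich G D E m dense 5F≤n X k k≤m =
    clique-in G D (E * (4 * D) ^ m) dense 5F≤n k E X (*-monoʳ-≤ E (^-monoʳ-≤ (4 * D) k≤m))
    where
    instance
      4D≢0 : NonZero (4 * D)
      4D≢0 = m*n≢0 4 D
      pow≢0 : NonZero ((4 * D) ^ m)
      pow≢0 = m^n≢0 (4 * D) m
      F≢0 : NonZero (E * (4 * D) ^ m)
      F≢0 = m*n≢0 E _

  nbrs : ∀ {n} → Graph n → Fin n → List (Fin n) → List (Fin n)
  nbrs G u = filter (λ x → adj G u x Bool.≟ true)

  length-nbrs-∷ : ∀ {n} (G : Graph n) u x L →
    length (nbrs G u (x ∷ L)) ≡ b2n (adj G u x) + length (nbrs G u L)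
  length-nbrs-∷ G u x L with adj G u x
  ... | true  = refl
  ... | false = refl

  double-count : ∀ {n} (G : Graph n) a N L → (∀ x → N ≤ a * card (adj G x)) →
    length L * N ≤ a * ∑ (λ u → length (nbrs G u L))
  double-count G a N [] deg = z≤n
  double-count G a N (x ∷ L) deg = begin
    N + length L * N                                            ≤⟨ +-mono-≤ (deg x) (double-count G a N L deg) ⟩
    a * card (adj G x) + a * ∑ (λ u → length (nbrs G u L))      ≡⟨ sym (*-distribˡ-+ a _ _) ⟩
    a * (card (adj G x) + ∑ (λ u → length (nbrs G u L)))        ≡⟨ cong (a *_) (sym (∑-distrib-+ _ _)) ⟩
    a * ∑ (λ u → b2n (adj G x u) + length (nbrs G u L))         ≡⟨ cong (a *_) (∑-cong λ u → trans
                                                                     (cong (λ b → b2n b + length (nbrs G u L)) (adj-sym G x u))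
                                                                     (sym (length-nbrs-∷ G u x L))) ⟩
    a * ∑ (λ u → length (nbrs G u (x ∷ L))) ∎
    where open ≤-Reasoning

  -- For each vertex of L the larger of its neighbours and its non-neighbours in the current set is
  -- kept, at the cost of a factor 2. Afterwards one member of W tells how all of W is joined to L.
  homogenise : ∀ {n} (G : Graph n) L (U : Fin n → Bool) → Σ (Fin n → Bool) λ W →
    (∀ u → W u ≡ true → U u ≡ true) × card U ≤ 2 ^ length L * card W ×
    (∀ {x u v} → x ∈ L → W u ≡ true → W v ≡ true → adj G u x ≡ adj G v x)
  homogenise G [] U = U , (λ _ → id) , m≤m+n _ 0 , λ ()
  homogenise {n} G (x ∷ L) U with homogenise G L U
  ... | W , W⊆U , big , hom = choose (≤-total (card (side true)) (card (side false)))
    where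
    open ≤-Reasoning
    side : Bool → Fin n → Bool
    side b u = W u ∧ does (adj G u x Bool.≟ b)
    side⁻ : ∀ b u → side b u ≡ true → W u ≡ true × adj G u x ≡ b
    side⁻ b u eq with W u | adj G u x Bool.≟ b
    ... | true | yes e = refl , e
    cover : card W ≤ card (side true) + card (side false)
    cover = card-cover λ v Wv → split v Wv (adj G v x) refl
      where
      split : ∀ v → W v ≡ true → ∀ b → adj G v x ≡ b → side true v ≡ true ⊎ side false v ≡ true
      split v Wv true  e rewrite Wv | e = inj₁ refl
      split v Wv false e rewrite Wv | e = inj₂ refl
    take-side : ∀ b → card W ≤ 2 * card (side b) → Σ (Fin n → Bool) λ W′ →
      (∀ u → W′ u ≡ true → U u ≡ true) × card U ≤ 2 ^ suc (length L) * card W′ ×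
      (∀ {y u v} → y ∈ x ∷ L → W′ u ≡ true → W′ v ≡ true → adj G u y ≡ adj G v y)
    take-side b half = side b , (λ u → W⊆U u ∘ proj₁ ∘ side⁻ b u) , bound , hom′
      where
      bound : card U ≤ 2 ^ suc (length L) * card (side b)
      bound = begin
        card U                                ≤⟨ big ⟩
        2 ^ length L * card W                 ≤⟨ *-monoʳ-≤ (2 ^ length L) half ⟩
        2 ^ length L * (2 * card (side b))    ≡⟨ assoc (2 ^ length L) _ ⟩
        2 * 2 ^ length L * card (side b) ∎
        where
        assoc : ∀ p q → p * (2 * q) ≡ 2 * p * q
        assoc = solve-∀
      hom′ : ∀ {y u v} → y ∈ x ∷ L → side b u ≡ true → side b v ≡ true → adj G u y ≡ adj G v y
      hom′ (here refl) su sv = trans (proj₂ (side⁻ b _ su)) (sym (proj₂ (side⁻ b _ sv)))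
      hom′ (there y∈)  su sv = hom y∈ (proj₁ (side⁻ b _ su)) (proj₁ (side⁻ b _ sv))
    choose : card (side true) ≤ card (side false) ⊎ card (side false) ≤ card (side true) → _
    choose (inj₁ t≤f) = take-side false (≤-trans cover (+-mono-≤ t≤f (m≤m+n _ 0)))
    choose (inj₂ f≤t) = take-side true (≤-trans cover (+-monoʳ-≤ (card (side true)) (≤-trans f≤t (m≤m+n _ 0))))

  Joined : ∀ {n} → Graph n → ℕ → (Fin n → Set) → List (Fin n) → Set
  Joined {n} G r Q X = Σ (List (Fin n)) λ S → r ≤ length S × Unique S × All Q S ×
    (∀ {u x} → u ∈ X → x ∈ S → adj G u x ≡ true)

  module _ {n} (G : Graph n) (r h : ℕ) .{{_ : NonZero r}} .{{_ : NonZero h}}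
           (deg : ∀ x → (2 + h) * n ≤ 2 * h * card (adj G x)) where

    private
      c = h * r

    module _ (O I : List (Fin n)) (lenO : length O ≡ c) (lenI : length I ≡ c) where

      rich : Fin n → Bool
      rich u = (r ≤ᵇ length (nbrs G u O)) ∧ (r ≤ᵇ length (nbrs G u I))

      rich⁻ : ∀ u → rich u ≡ true → r ≤ length (nbrs G u O) × r ≤ length (nbrs G u I)
      rich⁻ u eq with r ≤ᵇ length (nbrs G u O) in eq₁ | r ≤ᵇ length (nbrs G u I) in eq₂
      ... | true | true = ≤ᵇ⇒≤ _ _ (subst Bool.T (sym eq₁) _) , ≤ᵇ⇒≤ _ _ (subst Bool.T (sym eq₂) _)

      -- The degrees over O and I sum to at least 2c(1/2 + 1/h)n = (c + 2r)n, as c = hr. A vertex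
      -- that is not rich contributes at most c + r and any vertex at most 2c, so c times the number
      -- of rich vertices is at least rn.
      many-rich : n ≤ h * card rich
      many-rich = *-cancelˡ-≤ (2 * c) {{m*n≢0 2 c {{_}} {{m*n≢0 h r}}}} (+-cancelˡ-≤ (2 * c * h * n + 2 * c * n) _ _ (begin
        2 * c * h * n + 2 * c * n + 2 * c * n                 ≡⟨ s₁ c h n ⟩
        c * ((2 + h) * n) + c * ((2 + h) * n)                 ≡⟨ cong₂ (λ a b → a * ((2 + h) * n) + b * ((2 + h) * n)) (sym lenO) (sym lenI) ⟩
        length O * ((2 + h) * n) + length I * ((2 + h) * n)   ≤⟨ +-mono-≤ (double-count G (2 * h) _ O deg) (double-count G (2 * h) _ I deg) ⟩
        2 * h * ∑ (λ u → length (nbrs G u O)) + 2 * h * ∑ (λ u → length (nbrs G u I))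
                                                              ≡⟨ sym (trans (cong (2 * h *_) (∑-distrib-+ _ _)) (*-distribˡ-+ (2 * h) _ _)) ⟩
        2 * h * ∑ (λ u → length (nbrs G u O) + length (nbrs G u I))
                                                              ≤⟨ *-monoʳ-≤ (2 * h) (∑-mono-≤ pointwise) ⟩
        2 * h * ∑ (λ u → c + r + c * b2n (rich u))            ≡⟨ cong (2 * h *_) (trans (∑-distrib-+ {n} (λ _ → c + r) _)
                                                                   (cong₂ _+_ (∑-const n (c + r)) (sym (*-distribˡ-∑ c _)))) ⟩
        2 * h * (n * (c + r) + c * card rich)                 ≡⟨ s₂ h r n (card rich) ⟩
        2 * c * h * n + 2 * c * n + 2 * c * (h * card rich) ∎))
        where
        open ≤-Reasoning
        s₁ : ∀ c h n → 2 * c * h * n + 2 * c * n + 2 * c * n ≡ c * ((2 + h) * n) + c * ((2 + h) * n)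
        s₁ = solve-∀
        s₂ : ∀ h r n y → 2 * h * (n * (h * r + r) + h * r * y) ≡
                         2 * (h * r) * h * n + 2 * (h * r) * n + 2 * (h * r) * (h * y)
        s₂ = solve-∀
        ≤c : ∀ u L → length L ≡ c → length (nbrs G u L) ≤ c
        ≤c u L len = ≤-trans (length-filter _ L) (≤-reflexive len)
        pointwise : ∀ u → length (nbrs G u O) + length (nbrs G u I) ≤ c + r + c * b2n (rich u)
        pointwise u with r ≤ᵇ length (nbrs G u O) in eq₁ | r ≤ᵇ length (nbrs G u I) in eq₂
        ... | true | true = +-mono-≤ (≤-trans (≤c u O lenO) (m≤m+n c r))
                              (≤-trans (≤c u I lenI) (≤-reflexive (sym (*-identityʳ c))))
        ... | true | false = ≤-trans (+-mono-≤ (≤c u O lenO)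
                               (<⇒≤ (≰⇒> λ le → subst Bool.T eq₂ (≤⇒≤ᵇ le)))) (m≤m+n (c + r) _)
        ... | false | _ = ≤-trans (≤-trans (+-mono-≤
                               (<⇒≤ (≰⇒> λ le → subst Bool.T eq₁ (≤⇒≤ᵇ le))) (≤c u I lenI))
                               (≤-reflexive (+-comm r c))) (m≤m+n (c + r) _)

    -- At least n/h vertices are rich and at most n/(2h) lie outside A, so n/(2h) remain in `U`.
    -- Homogenising over the 2c vertices of O and I divides this by 2^(2c), which explains the bound
    -- on E.
    connect : ∀ {E m} → CliqueRich E m G → r ≤ m → 2 * h * 2 ^ (c + c) ≤ E → 
      ∀ {Q₁ Q₂ : Fin n → Set} O I → length O ≡ c → length I ≡ c → Unique O → Unique I → All Q₁ O → All Q₂ I →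
      (A : Fin n → Bool) → 2 * h * card (not ∘ A) ≤ n →
      Σ (List (Fin n)) λ X → length X ≡ r × Clique G X × All (λ v → A v ≡ true) X × Joined G r Q₁ X × Joined G r Q₂ X
    connect {E} {m} cl r≤m E≥ {Q₁} {Q₂} O I lenO lenI uO uI qO qI A few = finish
      where
      open ≤-Reasoning
      U : Fin n → Bool
      U u = rich O I lenO lenI u ∧ A u
      U⁻ : ∀ u → U u ≡ true → rich O I lenO lenI u ≡ true × A u ≡ true
      U⁻ u eq = ∧-trueˡ _ eq , ∧-trueʳ (rich O I lenO lenI u) eq
      cover : card (rich O I lenO lenI) ≤ card U + card (not ∘ A)
      cover = card-cover split
        where
        split : ∀ v → rich O I lenO lenI v ≡ true → U v ≡ true ⊎ not (A v) ≡ true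
        split v eq rewrite eq with A v
        ... | true  = inj₁ refl
        ... | false = inj₂ refl
      U-big : n ≤ 2 * h * card U
      U-big = +-cancelʳ-≤ n _ _ (begin
        n + n                                           ≤⟨ +-mono-≤ (many-rich O I lenO lenI) (many-rich O I lenO lenI) ⟩
        h * card (rich O I lenO lenI) + h * card (rich O I lenO lenI) ≡⟨ s₁ h _ ⟩
        2 * h * card (rich O I lenO lenI)               ≤⟨ *-monoʳ-≤ (2 * h) cover ⟩
        2 * h * (card U + card (not ∘ A))               ≡⟨ *-distribˡ-+ (2 * h) _ _ ⟩
        2 * h * card U + 2 * h * card (not ∘ A)         ≤⟨ +-monoʳ-≤ (2 * h * card U) few ⟩
        2 * h * card U + n ∎)
        where
        s₁ : ∀ h y → h * y + h * y ≡ 2 * h * y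
        s₁ = solve-∀
      hm = homogenise G (O ++ I) U
      W = proj₁ hm
      W⊆U = proj₁ (proj₂ hm)
      hom = proj₂ (proj₂ (proj₂ hm))
      W-big : n ≤ E * card W
      W-big = begin
        n                                                ≤⟨ U-big ⟩
        2 * h * card U                                   ≤⟨ *-monoʳ-≤ (2 * h) (proj₁ (proj₂ (proj₂ hm))) ⟩
        2 * h * (2 ^ length (O ++ I) * card W)           ≡⟨ sym (*-assoc (2 * h) _ _) ⟩
        2 * h * 2 ^ length (O ++ I) * card W             ≡⟨ cong (λ k → 2 * h * 2 ^ k * card W) (trans (length-++ O) (cong₂ _+_ lenO lenI)) ⟩
        2 * h * 2 ^ (c + c) * card W                     ≤⟨ *-monoˡ-≤ (card W) E≥ ⟩
        E * card W ∎
      finish : Σ (List (Fin n)) λ X → length X ≡ r × Clique G X × All (λ v → A v ≡ true) X × Joined G r Q₁ X × Joined G r Q₂ X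
      finish with cl W r r≤m W-big
      ... | [] , len , _ = contradiction (sym len) (ℕ.≢-nonZero⁻¹ r)
      -- `u₀` speaks for all of X: members of `W` agree on O ++ I, so its neighbours there, at least
      -- r on each side, are common to X.
      ... | X@(u₀ ∷ _) , len , clq , W₀ ∷ WX = X , len , clq , All.map (λ {v} → proj₂ ∘ U⁻ v ∘ W⊆U v) (W₀ ∷ WX) ,
              joined qO uO ∈-++⁺ˡ (proj₁ rich₀) , joined qI uI (∈-++⁺ʳ O) (proj₂ rich₀)
        where
        rich₀ = rich⁻ O I lenO lenI u₀ (proj₁ (U⁻ u₀ (W⊆U u₀ W₀)))
        joined : ∀ {Q L} → All Q L → Unique L → (∀ {x} → x ∈ L → x ∈ O ++ I) → r ≤ length (nbrs G u₀ L) → Joined G r Q X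
        joined {L = L} q uL L⊆ r≤ = nbrs G u₀ L , r≤ , Unique.filter⁺ _ uL , All.filter⁺ _ q ,
          λ u∈ x∈ → let (x∈L , a) = ∈-filter⁻ (λ x → adj G u₀ x Bool.≟ true) {xs = L} x∈ in
            trans (hom (L⊆ x∈L) (All.lookup (W₀ ∷ WX) u∈) W₀) a

  -- Labellings

  -- The states of a vertex while the cycle is built: dead vertices stay off the cycle, raw ones are
  -- not yet in any clique, and free i marks a vertex of clique i that may still be moved elsewhere.
  -- The clique con l is placed between the vertices out (l - 1) and inn l of cyclically
  -- consecutive cliques.
  data Label : Set where
    dead raw : Label
    free inn mid out con : ℕ → Label

  home : Label → Maybe ℕ
  home (free i) = just i
  home (inn i)  = just i
  home (mid i)  = just i
  home (out i)  = just i
  home _        = nothing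

  -- `dead` and `con` count as fixed together with the cores, so that every label is exactly one of
  -- free, raw and fixed, and bounding the fixed and raw vertices bounds all that cannot be moved.
  isFree isRaw isFixed : Label → Bool
  isFree (free _) = true
  isFree _        = false
  isRaw raw = true
  isRaw _   = false
  isFixed raw      = false
  isFixed (free _) = false
  isFixed _        = true

  isRaw⇒loose : ∀ ℓ → isRaw ℓ ≡ true → isFixed ℓ ≡ false
  isRaw⇒loose raw _ = refl

  isFree⇒loose : ∀ ℓ → isFree ℓ ≡ true → isFixed ℓ ≡ false
  isFree⇒loose (free _) _ = refl

  con? : ∀ l ℓ → Dec (ℓ ≡ con l)
  con? l (con k)  = map′ (cong con) (λ { refl → refl }) (k ℕ.≟ l)
  con? l dead     = no λ ()
  con? l raw      = no λ ()
  con? l (free _) = no λ ()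
  con? l (inn _)  = no λ ()
  con? l (mid _)  = no λ ()
  con? l (out _)  = no λ ()

  module _ {n : ℕ} where

    Has : (Fin n → Label) → Label → ℕ → Set
    Has f ℓ k = Σ (List (Fin n)) λ L → length L ≡ k × Unique L × All (λ v → f v ≡ ℓ) L

    relabel : (Fin n → Label) → List (Fin n) → (Fin n → Label) → Fin n → Label
    relabel f L g v = if elem L v then g v else f v

    relabel-∈ : ∀ {f L g v} → v ∈ L → relabel f L g v ≡ g v
    relabel-∈ v∈ rewrite ∈⇒elem v∈ = refl

    relabel-∉ : ∀ {f L g v} → v ∉ L → relabel f L g v ≡ f v
    relabel-∉ v∉ rewrite ∉⇒elem v∉ = refl

    relabel-cases : ∀ f L g v → (v ∈ L × relabel f L g v ≡ g v) ⊎ (v ∉ L × relabel f L g v ≡ f v)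
    relabel-cases f L g v with Any.any? (v Fin.≟_) L
    ... | yes v∈ = inj₁ (v∈ , relabel-∈ {f} {L} {g} v∈)
    ... | no  v∉ = inj₂ (v∉ , relabel-∉ {f} {L} {g} v∉)

    Loose : (Fin n → Label) → List (Fin n) → Set
    Loose f = All (λ v → isFixed (f v) ≡ false)

    -- A loose list contains no vertex with a fixed label. Hence cores, connectors and dead vertices
    -- survive every later relabelling.
    relabel-keep : ∀ {f L g v ℓ} → Loose f L → isFixed ℓ ≡ true → f v ≡ ℓ → relabel f L g v ≡ ℓ
    relabel-keep {f} {L} {g} {v} loose fix fv≡ = trans (relabel-∉ {f} {L} {g} λ v∈ →
      case trans (sym (All.lookup loose v∈)) (trans (cong isFixed fv≡) fix) of λ ()) fv≡

    Has-keep : ∀ {f L g ℓ k} → Loose f L → isFixed ℓ ≡ true → Has f ℓ k → Has (relabel f L g) ℓ k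
    Has-keep {f} {L} {g} loose fix (B , len , u , all) =
      B , len , u , All.map (relabel-keep {f} {L} {g} loose fix) all

  split-list : ∀ {A : Set} a {b} (L : List A) → length L ≡ a + b →
    Σ (List A) λ L₁ → Σ (List A) λ L₂ → L ≡ L₁ ++ L₂ × length L₁ ≡ a × length L₂ ≡ b
  split-list zero    L       len = [] , L , refl , refl , len
  split-list (suc a) (x ∷ L) len with split-list a L (suc-injective len)
  ... | L₁ , L₂ , refl , l₁ , l₂ = x ∷ L₁ , L₂ , refl , cong suc l₁ , l₂

  AllPairs-++⁻ : ∀ {A : Set} {R : A → A → Set} xs {ys} → AllPairs R (xs ++ ys) →
    AllPairs R xs × AllPairs R ys × (∀ {x y} → x ∈ xs → y ∈ ys → R x y)
  AllPairs-++⁻ [] ps = [] , ps , λ ()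
  AllPairs-++⁻ (x ∷ xs) (p ∷ ps) with AllPairs-++⁻ xs ps
  ... | pxs , pys , cross = All.++⁻ˡ xs p ∷ pxs , pys , λ
    { (here refl) y∈ → All.lookup (All.++⁻ʳ xs p) y∈ ; (there x∈) y∈ → cross x∈ y∈ }

  -- c vertices `inn`, r vertices `mid` and c vertices `out`.
  coreSize : ℕ → ℕ → ℕ
  coreSize r c = c + (r + c)

  module _ {n : ℕ} (G : Graph n) where

    adj⇒≢ : ∀ {u v} → adj G u v ≡ true → u ≢ v
    adj⇒≢ {u} a refl = case trans (sym a) (irref G u) of λ ()

    clique⇒unique : ∀ {L} → Clique G L → Unique L
    clique⇒unique = AllPairs.map adj⇒≢

    clique-adj : ∀ {L u v} → Clique G L → u ∈ L → v ∈ L → u ≢ v → adj G u v ≡ true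
    clique-adj (p ∷ ps) (here refl) (here refl) u≢v = contradiction refl u≢v
    clique-adj (p ∷ ps) (here refl) (there v∈)  u≢v = All.lookup p v∈
    clique-adj (p ∷ ps) (there u∈)  (here refl) u≢v = trans (adj-sym G _ _) (All.lookup p u∈)
    clique-adj (p ∷ ps) (there u∈)  (there v∈)  u≢v = clique-adj ps u∈ v∈ u≢v

    module _ (r c n′ : ℕ) where

      -- `clq` concerns whatever members a clique has at the moment, and the counts concern fixed
      -- vertices only, so nothing breaks when a free vertex leaves. The vertices kept off the cycle
      -- are chosen in advance: those numbered n′ and above.
      record Built (f : Fin n → Label) (t : ℕ) : Set where
        field
          clq   : ∀ {u v i} → u ≢ v → home (f u) ≡ just i → home (f v) ≡ just i → adj G u v ≡ true
          bound : ∀ {v i} → home (f v) ≡ just i → i < t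
          inns  : ∀ {k} → k < t → Has f (inn k) c
          mids  : ∀ {k} → k < t → Has f (mid k) r
          outs  : ∀ {k} → k < t → Has f (out k) c
          dead⇒ : ∀ {v} → f v ≡ dead → n′ ≤ toℕ v
          dead⇐ : ∀ {v} → n′ ≤ toℕ v → f v ≡ dead

      -- The new clique may mix raw vertices with free vertices taken from older cliques; the part
      -- `Y₄` outside the core is free again.
      module AddItem {f t} (S : Built f t) (Y₁ Y₂ Y₃ Y₄ : List (Fin n))
               (len₁ : length Y₁ ≡ c) (len₂ : length Y₂ ≡ r) (len₃ : length Y₃ ≡ c)
               (clqY : Clique G ((Y₁ ++ (Y₂ ++ Y₃)) ++ Y₄))
               (loose : Loose f ((Y₁ ++ (Y₂ ++ Y₃)) ++ Y₄)) where

        open Built S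

        core Y : List (Fin n)
        core = Y₁ ++ (Y₂ ++ Y₃)
        Y = core ++ Y₄

        new : Fin n → Label
        new v = if elem Y₁ v then inn t else if elem Y₂ v then mid t else if elem Y₃ v then out t else free t

        f′ : Fin n → Label
        f′ = relabel f Y new

        new-home : ∀ v → home (new v) ≡ just t
        new-home v with elem Y₁ v | elem Y₂ v | elem Y₃ v
        ... | true  | _     | _     = refl
        ... | false | true  | _     = refl
        ... | false | false | true  = refl
        ... | false | false | false = refl

        new-fixed : ∀ v → isFixed (new v) ≡ true → v ∈ core
        new-fixed v fix with elem Y₁ v in e₁ | elem Y₂ v in e₂ | elem Y₃ v in e₃
        ... | true  | _    | _    = ∈-++⁺ˡ (elem⇒∈ {L = Y₁} e₁)
        ... | false | true | _    = ∈-++⁺ʳ Y₁ (∈-++⁺ˡ (elem⇒∈ {L = Y₂} e₂))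
        ... | false | false | true = ∈-++⁺ʳ Y₁ (∈-++⁺ʳ Y₂ (elem⇒∈ {L = Y₃} e₃))

        new-∈ : ∀ {v} → v ∈ Y → home (f′ v) ≡ just t
        new-∈ {v} v∈ = trans (cong home (relabel-∈ {f = f} {L = Y} {g = new} v∈)) (new-home v)

        private
          cases : ∀ v → (v ∈ Y × f′ v ≡ new v) ⊎ (v ∉ Y × f′ v ≡ f v)
          cases = relabel-cases f Y new
          parts = AllPairs-++⁻ core clqY
          parts₁ = AllPairs-++⁻ Y₁ (proj₁ parts)
          parts₂ = AllPairs-++⁻ Y₂ (proj₁ (proj₂ parts₁))

          disjoint : ∀ {A B} → (∀ {x y} → x ∈ A → y ∈ B → adj G x y ≡ true) → ∀ {v} → v ∈ B → v ∉ A
          disjoint cross v∈B v∈A = adj⇒≢ (cross v∈A v∈B) refl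

          eq₁ : ∀ {v} → v ∈ Y₁ → f′ v ≡ inn t
          eq₁ {v} v∈ = trans (relabel-∈ {f = f} {L = Y} {g = new} (∈-++⁺ˡ (∈-++⁺ˡ v∈))) label
            where
            label : new v ≡ inn t
            label rewrite ∈⇒elem v∈ = refl

          eq₂ : ∀ {v} → v ∈ Y₂ → f′ v ≡ mid t
          eq₂ {v} v∈ = trans (relabel-∈ {f = f} {L = Y} {g = new} (∈-++⁺ˡ (∈-++⁺ʳ Y₁ (∈-++⁺ˡ v∈)))) label
            where
            label : new v ≡ mid t
            label rewrite ∉⇒elem (disjoint (proj₂ (proj₂ parts₁)) (∈-++⁺ˡ v∈)) | ∈⇒elem v∈ = refl

          eq₃ : ∀ {v} → v ∈ Y₃ → f′ v ≡ out t
          eq₃ {v} v∈ = trans (relabel-∈ {f = f} {L = Y} {g = new} (∈-++⁺ˡ (∈-++⁺ʳ Y₁ (∈-++⁺ʳ Y₂ v∈)))) label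
            where
            label : new v ≡ out t
            label rewrite ∉⇒elem (disjoint (proj₂ (proj₂ parts₁)) (∈-++⁺ʳ Y₂ v∈))
                        | ∉⇒elem (disjoint (proj₂ (proj₂ parts₂)) v∈) | ∈⇒elem v∈ = refl

          extend : ∀ {k j} {ℓ : ℕ → Label} → (∀ i → isFixed (ℓ i) ≡ true) → (∀ {k} → k < t → Has f (ℓ k) j) →
                   Has f′ (ℓ t) j → k < suc t → Has f′ (ℓ k) j
          extend fix old latest k<st with m≤n⇒m<n∨m≡n (≤-pred k<st)
          ... | inj₁ k<t  = Has-keep {f = f} {L = Y} {g = new} loose (fix _) (old k<t)
          ... | inj₂ refl = latest

        built : Built f′ (suc t)
        built = record
          { clq   = λ {u} {v} → clq′ {u} {v}
          ; bound = λ {v} → bound′ {v}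
          ; inns  = extend {ℓ = inn} (λ _ → refl) inns
                      (Y₁ , len₁ , clique⇒unique (proj₁ parts₁) , All.tabulate eq₁)
          ; mids  = extend {ℓ = mid} (λ _ → refl) mids
                      (Y₂ , len₂ , clique⇒unique (proj₁ parts₂) , All.tabulate eq₂)
          ; outs  = extend {ℓ = out} (λ _ → refl) outs
                      (Y₃ , len₃ , clique⇒unique (proj₁ (proj₂ parts₂)) , All.tabulate eq₃)
          ; dead⇒ = dead⇒′
          ; dead⇐ = λ le → relabel-keep {f = f} {L = Y} {g = new} loose refl (dead⇐ le)
          }
          where
          bound′ : ∀ {v i} → home (f′ v) ≡ just i → i < suc t
          bound′ {v} eq with cases v
          ... | inj₁ (v∈ , _)  = ≤-reflexive (cong suc (just-injective (trans (sym eq) (new-∈ v∈))))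
          ... | inj₂ (_ , f′≡) = m<n⇒m<1+n (bound (trans (sym (cong home f′≡)) eq))
          clq′ : ∀ {u v i} → u ≢ v → home (f′ u) ≡ just i → home (f′ v) ≡ just i → adj G u v ≡ true
          clq′ {u} {v} u≢v hu hv with cases u | cases v
          ... | inj₁ (u∈ , _) | inj₁ (v∈ , _) = clique-adj clqY u∈ v∈ u≢v
          ... | inj₁ (u∈ , _) | inj₂ (_ , f′v) = contradiction
                  (just-injective (trans (sym hu) (new-∈ u∈))) (<⇒≢ (bound (trans (sym (cong home f′v)) hv)))
          ... | inj₂ (_ , f′u) | inj₁ (v∈ , _) = contradiction
                  (just-injective (trans (sym hv) (new-∈ v∈))) (<⇒≢ (bound (trans (sym (cong home f′u)) hu)))
          ... | inj₂ (_ , f′u) | inj₂ (_ , f′v) =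
                  clq u≢v (trans (sym (cong home f′u)) hu) (trans (sym (cong home f′v)) hv)
          dead⇒′ : ∀ {v} → f′ v ≡ dead → n′ ≤ toℕ v
          dead⇒′ {v} eq with cases v
          ... | inj₁ (v∈ , _)  = case trans (sym (cong home eq)) (new-∈ v∈) of λ ()
          ... | inj₂ (_ , f′≡) = dead⇒ (trans (sym f′≡) eq)

        noCon : (∀ {v l} → f v ≢ con l) → ∀ {v l} → f′ v ≢ con l
        noCon none {v} eq with cases v
        ... | inj₁ (v∈ , _)  = case trans (sym (cong home eq)) (new-∈ v∈) of λ ()
        ... | inj₂ (_ , f′≡) = none (trans (sym f′≡) eq)

        fixed-count : card (isFixed ∘ f′) ≤ card (isFixed ∘ f) + coreSize r c
        fixed-count = ≤-trans (card-cover {s = elem core} cover) (+-monoʳ-≤ (card (isFixed ∘ f)) (≤-trans (card-elem-≤ core)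
          (≤-reflexive (trans (length-++ Y₁) (cong₂ _+_ len₁ (trans (length-++ Y₂) (cong₂ _+_ len₂ len₃)))))))
          where
          cover : ∀ v → isFixed (f′ v) ≡ true → isFixed (f v) ≡ true ⊎ elem core v ≡ true
          cover v fix with cases v
          ... | inj₁ (_ , f′≡) = inj₂ (∈⇒elem (new-fixed v (trans (sym (cong isFixed f′≡)) fix)))
          ... | inj₂ (_ , f′≡) = inj₁ (trans (sym (cong isFixed f′≡)) fix)

        raw-count : ∀ {L} → Unique L → All (λ v → isRaw (f v) ≡ true) L → (∀ {v} → v ∈ L → v ∈ Y) →
                    card (isRaw ∘ f′) + length L ≤ card (isRaw ∘ f)
        raw-count {L} uL rawL L⊆Y = ≤-trans (+-monoʳ-≤ (card (isRaw ∘ f′)) (card-elem-≥ uL)) (card-pack old (λ v e →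
          All.lookup rawL (elem⇒∈ e) , gone (L⊆Y (elem⇒∈ e))))
          where
          gone : ∀ {v} → v ∈ Y → isRaw (f′ v) ≡ false
          gone {v} v∈ with f′ v | new-∈ v∈
          ... | free _ | _ = refl
          ... | inn _  | _ = refl
          ... | mid _  | _ = refl
          ... | out _  | _ = refl
          old : ∀ v → isRaw (f′ v) ≡ true → isRaw (f v) ≡ true
          old v e with cases v
          ... | inj₁ (v∈ , _)  = case trans (sym e) (gone v∈) of λ ()
          ... | inj₂ (_ , f′≡) = trans (sym (cong isRaw f′≡)) e

  -- Partition into cliques

  module _ {n k : ℕ} (k≤n : k ≤ n) where

    initialSegment : List (Fin n)
    initialSegment = map (λ i → inject≤ i k≤n) (allFin k)

    initialSegment-unique : Unique initialSegment
    initialSegment-unique = Unique.map⁺ (Fin.inject≤-injective k≤n k≤n _ _) (Unique.allFin⁺ k)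

    length-initialSegment : length initialSegment ≡ k
    length-initialSegment = trans (length-map _ (allFin k)) (length-tabulate id)

    ∈-initialSegment⁺ : ∀ {v} → toℕ v < k → v ∈ initialSegment
    ∈-initialSegment⁺ {v} v<k = subst (_∈ initialSegment)
      (Fin.toℕ-injective (trans (Fin.toℕ-inject≤ (fromℕ< v<k) k≤n) (Fin.toℕ-fromℕ< v<k)))
      (∈-map⁺ _ (∈-allFin (fromℕ< v<k)))

    ∈-initialSegment⁻ : ∀ {v} → v ∈ initialSegment → toℕ v < k
    ∈-initialSegment⁻ v∈ with ∈-map⁻ _ v∈
    ... | i , _ , refl = subst (_< k) (sym (Fin.toℕ-inject≤ i k≤n)) (Fin.toℕ<n i)

  initialLabel : ∀ {n} → ℕ → Fin n → Label
  initialLabel n′ v with toℕ v <? n′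
  ... | yes _ = raw
  ... | no  _ = dead

  module _ {n : ℕ} (G : Graph n) (r c n′ s : ℕ) where

    record Stage (f : Fin n → Label) (t : ℕ) : Set where
      field
        built  : Built G r c n′ f t
        noCon  : ∀ {v l} → f v ≢ con l
        fixed≤ : card (isFixed ∘ f) ≤ coreSize r c * t + s

    initialStage : n′ ≤ n → n ≤ n′ + s → Stage (initialLabel n′) 0
    initialStage n′≤n n≤ = record
      { built = record
        { clq   = λ {u} _ hu _ → contradiction hu (homeless u)
        ; bound = λ {v} hv → contradiction hv (homeless v)
        ; inns  = λ ()
        ; mids  = λ ()
        ; outs  = λ ()
        ; dead⇒ = dead⇒
        ; dead⇐ = dead⇐
        }
      ; noCon  = noCon
      ; fixed≤ = ≤-trans few (m≤n+m s _)
      }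
      where
      homeless : ∀ v {i} → home (initialLabel n′ v) ≢ just i
      homeless v eq with toℕ v <? n′
      homeless v () | yes _
      homeless v () | no  _
      dead⇒ : ∀ {v} → initialLabel n′ v ≡ dead → n′ ≤ toℕ v
      dead⇒ {v} eq with toℕ v <? n′
      ... | no v≮ = ≮⇒≥ v≮
      dead⇐ : ∀ {v} → n′ ≤ toℕ v → initialLabel n′ v ≡ dead
      dead⇐ {v} le with toℕ v <? n′
      ... | yes v<  = contradiction le (<⇒≱ v<)
      ... | no  _   = refl
      noCon : ∀ {v l} → initialLabel n′ v ≢ con l
      noCon {v} eq with toℕ v <? n′
      noCon () | yes _
      noCon () | no  _
      few : card (isFixed ∘ initialLabel n′) ≤ s
      few = +-cancelʳ-≤ n′ _ _ (begin
        card (isFixed ∘ initialLabel n′) + n′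
          ≤⟨ +-monoʳ-≤ _ (≤-trans (≤-reflexive (sym (length-initialSegment n′≤n))) (card-elem-≥ (initialSegment-unique n′≤n))) ⟩
        card (isFixed ∘ initialLabel n′) + card (elem (initialSegment n′≤n))
          ≤⟨ card-pack {p = λ _ → true} (λ _ _ → refl) (λ v e → refl , alive v (∈-initialSegment⁻ n′≤n (elem⇒∈ e))) ⟩
        card {n} (λ _ → true) ≤⟨ card≤n _ ⟩
        n                     ≤⟨ n≤ ⟩
        n′ + s                ≡⟨ +-comm n′ s ⟩
        s + n′ ∎)
        where
        open ≤-Reasoning
        alive : ∀ v → toℕ v < n′ → isFixed (initialLabel n′ v) ≡ false
        alive v v< with toℕ v <? n′
        ... | yes _  = refl
        ... | no  v≮ = contradiction v< v≮

    -- `b` counts the members beyond the core: `m ∸ core` for a greedy clique, 1 for a clique made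
    -- around a left-over vertex. The last component measures the progress of either loop.
    addItem : ∀ {f t} → Stage f t → ∀ b L → length L ≡ coreSize r c + b → Clique G L → Loose f L →
      Σ (Fin n → Label) λ f′ → Stage f′ (suc t) ×
        (∀ {W} → Unique W → All (λ v → isRaw (f v) ≡ true) W → (∀ {v} → v ∈ W → v ∈ L) →
          card (isRaw ∘ f′) + length W ≤ card (isRaw ∘ f))
    addItem {f} {t} S b L len clq loose with split-list (coreSize r c) L len
    ... | K , Y₄ , refl , lenK , _ with split-list c K lenK
    ... | Y₁ , K′ , refl , len₁ , lenK′ with split-list r K′ lenK′
    ... | Y₂ , Y₃ , refl , len₂ , len₃ = f′ , record
          { built  = Add.built
          ; noCon  = Add.noCon noCon
          ; fixed≤ = ≤-trans Add.fixed-count (≤-trans (+-monoˡ-≤ _ fixed≤) (≤-reflexive (s₁ (coreSize r c) t s)))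
          } , Add.raw-count
      where
      open Stage S
      module Add = AddItem G r c n′ built Y₁ Y₂ Y₃ Y₄ len₁ len₂ len₃ clq loose
      f′ = Add.f′
      s₁ : ∀ k t s → k * t + s + k ≡ k * suc t + s
      s₁ = solve-∀

  notFree≤ : ∀ {n} (f : Fin n → Label) → card (not ∘ isFree ∘ f) ≤ card (isFixed ∘ f) + card (isRaw ∘ f)
  notFree≤ f = card-cover λ v → split (f v)
    where
    split : ∀ ℓ → not (isFree ℓ) ≡ true → isFixed ℓ ≡ true ⊎ isRaw ℓ ≡ true
    split dead    _ = inj₁ refl
    split raw     _ = inj₂ refl
    split (inn _) _ = inj₁ refl
    split (mid _) _ = inj₁ refl
    split (out _) _ = inj₁ refl
    split (con _) _ = inj₁ refl

  -- `x` is the number of vertices that are not free, `y` that of cliques and raw vertices. The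
  -- middle hypothesis is my ≤ 2n with m = 8hK; it gives Ky ≤ n/(4h), and s adds at most n/(4h).
  budget : ∀ {n x y s} h K → x ≤ K * y + s → 8 * h * K * y ≤ 2 * n → 4 * h * s ≤ n →
           2 * h * x ≤ n
  budget {n} {x} {y} {s} h K x≤ items≤ s≤ = *-cancelˡ-≤ 2 (begin
    2 * (2 * h * x)                ≤⟨ *-monoʳ-≤ 2 (*-monoʳ-≤ (2 * h) x≤) ⟩
    2 * (2 * h * (K * y + s))      ≡⟨ s₁ h K y s ⟩
    4 * h * K * y + 4 * h * s      ≤⟨ +-mono-≤ (*-cancelˡ-≤ 2 (≤-trans (≤-reflexive (s₂ h K y)) items≤)) s≤ ⟩
    n + n                          ≡⟨ s₃ n ⟩
    2 * n ∎)
    where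
    open ≤-Reasoning
    s₁ : ∀ h K y s → 2 * (2 * h * (K * y + s)) ≡ 4 * h * K * y + 4 * h * s
    s₁ = solve-∀
    s₂ : ∀ h K y → 2 * (4 * h * K * y) ≡ 8 * h * K * y
    s₂ = solve-∀
    s₃ : ∀ n → n + n ≡ 2 * n
    s₃ = solve-∀

  module Parameters (r h : ℕ) where

    -- `K` is the charge per clique: its core, the r vertices of one connector, and 1, which makes
    -- `K` positive and hence enough to pay for a raw vertex as well.
    c core K : ℕ
    c    = h * r
    core = coreSize r c
    K    = core + r + 1

  module _ (r h m : ℕ) .{{_ : NonZero h}} (m≡ : m ≡ 8 * h * Parameters.K r h) where

    open Parameters r h

    K≤m : K ≤ m
    K≤m = ≤-trans (m≤n*m K (8 * h) {{m*n≢0 8 h}}) (≤-reflexive (sym m≡))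

    core≤m : core ≤ m
    core≤m = ≤-trans (≤-trans (m≤m+n core r) (m≤m+n (core + r) 1)) K≤m

    r≤m : r ≤ m
    r≤m = ≤-trans (≤-trans (m≤n+m r core) (m≤m+n (core + r) 1)) K≤m

    1≤m : 1 ≤ m
    1≤m = ≤-trans (m≤n+m 1 (core + r)) K≤m

  module Partition {n : ℕ} (G : Graph n) (r h s n′ E m : ℕ) .{{_ : NonZero h}} (2≤h : 2 ≤ h)
           (m≡ : m ≡ 8 * h * Parameters.K r h) (cl : CliqueRich E m G) (m≤E : m ≤ E) (4≤E : 4 ≤ E)
           (deg : ∀ x → (2 + h) * n ≤ 2 * h * card (adj G x)) (s≤ : 4 * h * s ≤ n) where

    open Parameters r h

    private
      St = Stage G r c n′ s
      #raw : (Fin n → Label) → ℕ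
      #raw f = card (isRaw ∘ f)

    extract : ∀ {f t} → St f t → n ≤ m * #raw f →
      Σ (Fin n → Label) λ f′ → St f′ (suc t) × #raw f′ + m ≤ #raw f
    extract {f} S large with cl (isRaw ∘ f) m ≤-refl (≤-trans large (*-monoˡ-≤ _ m≤E))
    ... | L , len , clq , rawL with addItem G r c n′ s S (m ∸ core) L
              (trans len (sym (m+[n∸m]≡n (core≤m r h m m≡)))) clq (All.map (λ {v} → isRaw⇒loose (f v)) rawL)
    ...   | f′ , S′ , fewer = f′ , S′ ,
            subst (λ k → #raw f′ + k ≤ #raw f) len (fewer (clique⇒unique G clq) rawL id)

    -- Each extraction uses up at least m raw vertices, which preserves mt + #raw ≤ n. The loop
    -- stops when m times #raw is below n, and the two bounds add up to 2n.
    big-cliques : ∀ fuel {f t} → #raw f ≤ fuel → St f t → m * t + #raw f ≤ n →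
      Σ (Fin n → Label) λ f → Σ ℕ λ t → St f t × m * (t + #raw f) ≤ 2 * n
    big-cliques fuel {f} {t} raw≤ S size with n ≤? m * #raw f
    ... | no small = f , t , S , (begin
            m * (t + #raw f)         ≡⟨ *-distribˡ-+ m t _ ⟩
            m * t + m * #raw f       ≤⟨ +-mono-≤ (≤-trans (m≤m+n _ _) size) (<⇒≤ (≰⇒> small)) ⟩
            n + n                    ≡⟨ cong (n +_) (sym (+-identityʳ n)) ⟩
            2 * n ∎)
      where open ≤-Reasoning
    big-cliques zero {f} raw≤ S size | yes large = contradiction (begin
            1              ≤⟨ 1≤m r h m m≡ ⟩
            m              ≤⟨ m≤n+m m _ ⟩
            _ + m          ≤⟨ proj₂ (proj₂ (extract S large)) ⟩
            #raw f         ≤⟨ raw≤ ⟩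
            0 ∎) λ ()
      where open ≤-Reasoning
    big-cliques (suc fuel) {f} {t} raw≤ S size | yes large with extract S large
    ... | f′ , S′ , fewer = big-cliques fuel
            (≤-pred (≤-trans (≤-trans (≤-reflexive (+-comm 1 _)) (≤-trans (+-monoʳ-≤ (#raw f′) (1≤m r h m m≡)) fewer)) raw≤)) S′ (begin
            m * suc t + #raw f′    ≡⟨ rearrange m t (#raw f′) ⟩
            m * t + (#raw f′ + m)  ≤⟨ +-monoʳ-≤ (m * t) fewer ⟩
            m * t + #raw f         ≤⟨ size ⟩
            n ∎)
      where
      open ≤-Reasoning
      rearrange : ∀ m t x → m * suc t + x ≡ m * t + (x + m)
      rearrange = solve-∀

    few-not-free : ∀ {f t} → St f t → m * (t + #raw f) ≤ 2 * n → 2 * h * card (not ∘ isFree ∘ f) ≤ n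
    few-not-free {f} {t} S size = budget h K (begin
      card (not ∘ isFree ∘ f)                     ≤⟨ notFree≤ f ⟩
      card (isFixed ∘ f) + #raw f                 ≤⟨ +-monoˡ-≤ _ (Stage.fixed≤ S) ⟩
      core * t + s + #raw f                       ≤⟨ m≤m+n _ (r * t + t + (core + r) * #raw f) ⟩
      core * t + s + #raw f + (r * t + t + (core + r) * #raw f) ≡⟨ rearrange core r s t (#raw f) ⟩
      K * (t + #raw f) + s ∎) (subst (λ k → k * (t + #raw f) ≤ 2 * n) m≡ size) s≤
      where
      open ≤-Reasoning
      rearrange : ∀ k r s t x → k * t + s + x + (r * t + t + (k + r) * x) ≡ (k + r + 1) * (t + x) + s
      rearrange = solve-∀

    half-degree : ∀ w → n ≤ 2 * card (adj G w)
    half-degree w = *-cancelˡ-≤ h (begin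
      h * n                     ≤⟨ m≤n+m (h * n) (2 * n) ⟩
      2 * n + h * n             ≡⟨ sym (*-distribʳ-+ n 2 h) ⟩
      (2 + h) * n               ≤⟨ deg w ⟩
      2 * h * card (adj G w)    ≡⟨ rearrange h _ ⟩
      h * (2 * card (adj G w)) ∎)
      where
      open ≤-Reasoning
      rearrange : ∀ h x → 2 * h * x ≡ h * (2 * x)
      rearrange = solve-∀

    free-neighbours : (Fin n → Label) → Fin n → Fin n → Bool
    free-neighbours f w v = adj G w v ∧ isFree (f v)

    -- Of at least n/2 neighbours, at most n/(2h) ≤ n/4 are not free; this is where h ≥ 2 enters.
    many-free-neighbours : ∀ {f t} → St f t → m * (t + #raw f) ≤ 2 * n → ∀ w →
      n ≤ 4 * card (free-neighbours f w)
    many-free-neighbours {f} {t} S size w = many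
      where
      open ≤-Reasoning
      avail = free-neighbours f w
      cover : ∀ v → adj G w v ≡ true → avail v ≡ true ⊎ not (isFree (f v)) ≡ true
      cover v a rewrite a with isFree (f v)
      ... | true  = inj₁ refl
      ... | false = inj₂ refl
      many : n ≤ 4 * card avail
      many = +-cancelʳ-≤ n _ _ (begin
        n + n                                               ≤⟨ +-mono-≤ (half-degree w) (half-degree w) ⟩
        2 * card (adj G w) + 2 * card (adj G w)             ≡⟨ double (card (adj G w)) ⟩
        4 * card (adj G w)                                  ≤⟨ *-monoʳ-≤ 4 (card-cover cover) ⟩
        4 * (card avail + card (not ∘ isFree ∘ f))          ≡⟨ *-distribˡ-+ 4 (card avail) _ ⟩
        4 * card avail + 4 * card (not ∘ isFree ∘ f)        ≤⟨ +-monoʳ-≤ (4 * card avail) (≤-trans (*-monoˡ-≤ _ (*-monoʳ-≤ 2 2≤h)) (few-not-free S size)) ⟩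
        4 * card avail + n ∎)
        where
        double : ∀ x → 2 * x + 2 * x ≡ 4 * x
        double = solve-∀

    -- The core consists of free neighbours of `w`. Placed last in the list, `w` falls outside the
    -- core and becomes free itself.
    absorb : ∀ {f t} → St f t → m * (t + #raw f) ≤ 2 * n → ∀ w → isRaw (f w) ≡ true →
      Σ (Fin n → Label) λ f′ → St f′ (suc t) × #raw f′ + 1 ≤ #raw f
    absorb {f} {t} S size w raw-w =
      item (cl (free-neighbours f w) core (core≤m r h m m≡) (≤-trans (many-free-neighbours S size w) (*-monoˡ-≤ _ 4≤E)))
      where
      item : (Σ (List (Fin n)) λ L → length L ≡ core × Clique G L × All (λ v → free-neighbours f w v ≡ true) L) →
        Σ (Fin n → Label) λ f′ → St f′ (suc t) × #raw f′ + 1 ≤ #raw f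
      item (L , len , clq , availL) =
        let (f′ , S′ , fewer) = addItem G r c n′ s S 1 (L ++ [ w ]) len′ clq′ loose
        in f′ , S′ , fewer {W = [ w ]} ([] ∷ []) (raw-w ∷ []) (∈-++⁺ʳ L)
        where
        len′ : length (L ++ [ w ]) ≡ core + 1
        len′ = trans (length-++ L) (cong (_+ 1) len)
        clq′ : Clique G (L ++ [ w ])
        clq′ = AllPairs.++⁺ clq ([] ∷ [])
          (All.map (λ {v} a → trans (adj-sym G v w) (∧-trueˡ _ a) ∷ []) availL)
        loose : Loose f (L ++ [ w ])
        loose = All.++⁺ (All.map (λ {v} a → isFree⇒loose (f v) (∧-trueʳ (adj G w v) a)) availL)
                        (isRaw⇒loose (f w) raw-w ∷ [])

    -- Every round trades at least one raw vertex for one clique, so t + #raw never grows and the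
    -- budget holds to the end.
    absorb-all : ∀ fuel {f t} → #raw f ≤ fuel → St f t → m * (t + #raw f) ≤ 2 * n →
      Σ (Fin n → Label) λ f → Σ ℕ λ t → St f t × #raw f ≡ 0 × m * t ≤ 2 * n
    absorb-all zero {f} {t} raw≤ S size =
      f , t , S , n≤0⇒n≡0 raw≤ , ≤-trans (*-monoʳ-≤ m (m≤m+n t _)) size
    absorb-all (suc fuel) {f} {t} raw≤ S size with 1 ≤? #raw f
    ... | no none = absorb-all fuel (≤-trans (≤-pred (≰⇒> none)) z≤n) S size
    ... | yes some =
      let (w , raw-w)       = card-inhabited some
          (f′ , S′ , fewer) = absorb S size w raw-w
      in absorb-all fuel (≤-pred (≤-trans (≤-reflexive (+-comm 1 _)) (≤-trans fewer raw≤))) S′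
           (≤-trans (*-monoʳ-≤ m (≤-trans (≤-reflexive (rearrange t (#raw f′))) (+-monoʳ-≤ t fewer))) size)
      where
      rearrange : ∀ t x → suc t + x ≡ t + (x + 1)
      rearrange = solve-∀

    partition : n′ ≤ n → n ≤ n′ + s →
      Σ (Fin n → Label) λ f → Σ ℕ λ t → St f t × (∀ v → isRaw (f v) ≡ false) × m * t ≤ 2 * n
    partition n′≤n n≤ =
      let (f , t , S , size) = big-cliques n (card≤n _) (initialStage G r c n′ s n′≤n n≤)
            (≤-trans (≤-reflexive (cong (_+ #raw (initialLabel n′)) (*-zeroʳ m))) (card≤n _))
          (f′ , t′ , S′ , none , size′) = absorb-all (#raw f) ≤-refl S size
      in f′ , t′ , S′ , card-empty none , size′

  -- Linking the cliques cyclically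

  card-none : ∀ {n} {p : Fin n → Bool} → (∀ v → p v ≡ false) → card p ≡ 0
  card-none {n} none = n≤0⇒n≡0 (≤-trans (card-mono {q = λ _ → false} λ v e → trans (sym (none v)) e)
    (≤-reflexive (trans (∑-const n 0) (*-zeroʳ n))))

  previous : ℕ → ℕ → ℕ
  previous t zero    = ℕ.pred t
  previous t (suc l) = l

  next : ℕ → ℕ → ℕ
  next t k = if does (suc k ℕ.≟ t) then 0 else suc k

  next-last : ∀ {t k} → suc k ≡ t → next t k ≡ 0
  next-last {t} {k} eq rewrite dec-true (suc k ℕ.≟ t) eq = refl

  next-suc : ∀ {t k} → suc k ≢ t → next t k ≡ suc k
  next-suc {t} {k} neq rewrite dec-false (suc k ℕ.≟ t) neq = refl

  previous-< : ∀ {t l} → l < t → previous t l < t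
  previous-< {suc t} {zero}  _   = ≤-refl
  previous-< {t}     {suc l} l<t = <⇒≤ l<t

  next-< : ∀ {t k} → k < t → next t k < t
  next-< {t} {k} k<t with suc k ℕ.≟ t
  ... | yes eq  = subst (_< t) (sym (next-last eq)) (≤-trans (s≤s z≤n) k<t)
  ... | no  neq = subst (_< t) (sym (next-suc neq)) (≤∧≢⇒< k<t neq)

  previous-next : ∀ t k → previous t (next t k) ≡ k
  previous-next t k with suc k ℕ.≟ t
  ... | yes eq  = trans (cong (previous t) (next-last eq)) (cong ℕ.pred (sym eq))
  ... | no  neq = cong (previous t) (next-suc neq)

  module _ {n : ℕ} (G : Graph n) (r : ℕ) where

    -- Quantifying over the label `con l` instead of a list makes this the condition `JoinedTo l` by
    -- which vertices are later assigned to blocks.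
    Attached : (Fin n → Label) → Label → ℕ → Set
    Attached f ℓ l = Σ (List (Fin n)) λ S → r ≤ length S × Unique S × All (λ v → f v ≡ ℓ) S ×
      (∀ {u x} → f u ≡ con l → x ∈ S → adj G u x ≡ true)

    record Connected (f : Fin n → Label) (t l : ℕ) : Set where
      field
        connector : Has f (con l) r
        clique    : ∀ {u v} → u ≢ v → f u ≡ con l → f v ≡ con l → adj G u v ≡ true
        entry     : Attached f (inn l) l
        exit      : Attached f (out (previous t l)) l

  module _ {n : ℕ} (G : Graph n) (r h s n′ E m : ℕ) .{{_ : NonZero r}} .{{_ : NonZero h}}
           (m≡ : m ≡ 8 * h * Parameters.K r h) where

    open Parameters r h

    -- By `fresh`, the next connector will be the entire class `con j`; `fixed≤` charges r vertices
    -- per connector.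
    record Linked (f : Fin n → Label) (t j : ℕ) : Set where
      field
        built  : Built G r c n′ f t
        done   : ∀ {l} → l < j → Connected G r f t l
        fresh  : ∀ {l v} → j ≤ l → f v ≢ con l
        noRaw  : ∀ v → isRaw (f v) ≡ false
        fixed≤ : card (isFixed ∘ f) ≤ core * t + s + r * j

    module Link (cl : CliqueRich E m G) (E≥ : 2 * h * 2 ^ (c + c) ≤ E)
             (deg : ∀ x → (2 + h) * n ≤ 2 * h * card (adj G x)) (s≤ : 4 * h * s ≤ n) where

      few-not-free : ∀ {f t j} → m * t ≤ 2 * n → j ≤ t → Linked f t j → 2 * h * card (not ∘ isFree ∘ f) ≤ n
      few-not-free {f} {t} {j} size j≤t S = budget h K (begin
        card (not ∘ isFree ∘ f)                   ≤⟨ notFree≤ f ⟩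
        card (isFixed ∘ f) + card (isRaw ∘ f)     ≡⟨ cong (card (isFixed ∘ f) +_) (card-none noRaw) ⟩
        card (isFixed ∘ f) + 0                    ≡⟨ +-identityʳ _ ⟩
        card (isFixed ∘ f)                        ≤⟨ fixed≤ ⟩
        core * t + s + r * j                      ≤⟨ +-monoʳ-≤ (core * t + s) (*-monoʳ-≤ r j≤t) ⟩
        core * t + s + r * t                      ≤⟨ m≤m+n _ t ⟩
        core * t + s + r * t + t                  ≡⟨ rearrange core r s t ⟩
        K * t + s ∎) (subst (λ k → k * t ≤ 2 * n) m≡ size) s≤
        where
        open ≤-Reasoning
        open Linked S
        rearrange : ∀ k r s t → k * t + s + r * t + t ≡ (k + r + 1) * t + s
        rearrange = solve-∀

      module Step {f t j} (S : Linked f t j) (X : List (Fin n)) (lenX : length X ≡ r) (clqX : Clique G X)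
               (freeX : All (λ v → isFree (f v) ≡ true) X)
               (joinIn : Joined G r (λ v → f v ≡ inn j) X)
               (joinOut : Joined G r (λ v → f v ≡ out (previous t j)) X) where

        open Linked S
        open Built built

        f′ : Fin n → Label
        f′ = relabel f X (const (con j))

        loose : Loose f X
        loose = All.map (λ {v} → isFree⇒loose (f v)) freeX

        cases : ∀ v → (v ∈ X × f′ v ≡ con j) ⊎ (v ∉ X × f′ v ≡ f v)
        cases = relabel-cases f X (const (con j))

        keep : ∀ {v ℓ} → isFixed ℓ ≡ true → f v ≡ ℓ → f′ v ≡ ℓ
        keep = relabel-keep {f = f} {L = X} {g = const (con j)} loose

        keep-Has : ∀ {ℓ k} → isFixed ℓ ≡ true → Has f ℓ k → Has f′ ℓ k
        keep-Has = Has-keep {f = f} {L = X} {g = const (con j)} loose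

        home⁻ : ∀ {v i} → home (f′ v) ≡ just i → home (f v) ≡ just i
        home⁻ {v} eq with cases v
        ... | inj₁ (_ , f′≡) = case trans (sym (cong home f′≡)) eq of λ ()
        ... | inj₂ (_ , f′≡) = trans (sym (cong home f′≡)) eq

        new⁻ : ∀ {v} → f′ v ≡ con j → v ∈ X
        new⁻ {v} eq with cases v
        ... | inj₁ (v∈ , _)  = v∈
        ... | inj₂ (_ , f′≡) = contradiction (trans (sym f′≡) eq) (fresh ≤-refl)

        old⁻ : ∀ {v l} → l ≢ j → f′ v ≡ con l → f v ≡ con l
        old⁻ {v} l≢j eq with cases v
        ... | inj₁ (_ , f′≡) = contradiction (con-injective (trans (sym eq) f′≡)) l≢j
          where
          con-injective : ∀ {k l} → con k ≡ con l → k ≡ l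
          con-injective refl = refl
        ... | inj₂ (_ , f′≡) = trans (sym f′≡) eq

        built′ : Built G r c n′ f′ t
        built′ = record
          { clq   = λ u≢v hu hv → clq u≢v (home⁻ hu) (home⁻ hv)
          ; bound = λ hv → bound (home⁻ hv)
          ; inns  = λ k<t → keep-Has refl (inns k<t)
          ; mids  = λ k<t → keep-Has refl (mids k<t)
          ; outs  = λ k<t → keep-Has refl (outs k<t)
          ; dead⇒ = dead⁻
          ; dead⇐ = λ le → keep refl (dead⇐ le)
          }
          where
          dead⁻ : ∀ {v} → f′ v ≡ dead → n′ ≤ toℕ v
          dead⁻ {v} eq with cases v
          ... | inj₁ (_ , f′≡) = case trans (sym f′≡) eq of λ ()
          ... | inj₂ (_ , f′≡) = dead⇒ (trans (sym f′≡) eq)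

        old-attached : ∀ {ℓ l} → l ≢ j → isFixed ℓ ≡ true → Attached G r f ℓ l → Attached G r f′ ℓ l
        old-attached l≢j fix (B , r≤ , u , all , att) =
          B , r≤ , u , All.map (keep fix) all , λ fu x∈ → att (old⁻ l≢j fu) x∈

        old-connected : ∀ {l} → l ≢ j → Connected G r f t l → Connected G r f′ t l
        old-connected l≢j C = record
          { connector = keep-Has refl connector
          ; clique    = λ u≢v fu fv → clique u≢v (old⁻ l≢j fu) (old⁻ l≢j fv)
          ; entry     = old-attached l≢j refl entry
          ; exit      = old-attached l≢j refl exit
          }
          where open Connected C

        new-connected : Connected G r f′ t j
        new-connected = record
          { connector = X , lenX , clique⇒unique G clqX ,
                        All.tabulate (relabel-∈ {f = f} {L = X} {g = const (con j)})
          ; clique    = λ u≢v fu fv → clique-adj G clqX (new⁻ fu) (new⁻ fv) u≢v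
          ; entry     = attach refl joinIn
          ; exit      = attach refl joinOut
          }
          where
          attach : ∀ {ℓ} → isFixed ℓ ≡ true → Joined G r (λ v → f v ≡ ℓ) X → Attached G r f′ ℓ j
          attach fix (B , r≤ , u , all , att) = B , r≤ , u , All.map (keep fix) all , λ fu x∈ → att (new⁻ fu) x∈

        linked : Linked f′ t (suc j)
        linked = record
          { built  = built′
          ; done   = done′
          ; fresh  = fresh′
          ; noRaw  = noRaw′
          ; fixed≤ = fixed-count
          }
          where
          done′ : ∀ {l} → l < suc j → Connected G r f′ t l
          done′ l<sj with m≤n⇒m<n∨m≡n (≤-pred l<sj)
          ... | inj₁ l<j  = old-connected (<⇒≢ l<j) (done l<j)
          ... | inj₂ refl = new-connected
          fresh′ : ∀ {l v} → suc j ≤ l → f′ v ≢ con l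
          fresh′ j<l eq = fresh (<⇒≤ j<l) (old⁻ (≢-sym (<⇒≢ j<l)) eq)
          noRaw′ : ∀ v → isRaw (f′ v) ≡ false
          noRaw′ v with cases v
          ... | inj₁ (_ , f′≡) = cong isRaw f′≡
          ... | inj₂ (_ , f′≡) = trans (cong isRaw f′≡) (noRaw v)
          cover : ∀ v → isFixed (f′ v) ≡ true → isFixed (f v) ≡ true ⊎ elem X v ≡ true
          cover v fix with cases v
          ... | inj₁ (v∈ , _)  = inj₂ (∈⇒elem v∈)
          ... | inj₂ (_ , f′≡) = inj₁ (trans (sym (cong isFixed f′≡)) fix)
          fixed-count : card (isFixed ∘ f′) ≤ core * t + s + r * suc j
          fixed-count = begin
            card (isFixed ∘ f′)                    ≤⟨ card-cover cover ⟩
            card (isFixed ∘ f) + card (elem X)     ≤⟨ +-mono-≤ fixed≤ (≤-trans (card-elem-≤ X) (≤-reflexive lenX)) ⟩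
            core * t + s + r * j + r               ≡⟨ rearrange (core * t + s) r j ⟩
            core * t + s + r * suc j ∎
            where
            open ≤-Reasoning
            rearrange : ∀ a r j → a + r * j + r ≡ a + r * suc j
            rearrange = solve-∀

      link : ∀ {f t j} → m * t ≤ 2 * n → j < t → Linked f t j → Σ (Fin n → Label) λ f′ → Linked f′ t (suc j)
      link {f} {t} {j} size j<t S =
        let open Built (Linked.built S)
            (O , lenO , uO , allO) = outs (previous-< j<t)
            (I , lenI , uI , allI) = inns j<t
            (X , lenX , clqX , freeX , joinOut , joinIn) =
              connect G r h deg cl (r≤m r h m m≡) E≥ O I lenO lenI uO uI allO allI (isFree ∘ f) (few-not-free size (<⇒≤ j<t) S)
        in _ , Step.linked S X lenX clqX freeX joinIn joinOut

      link-all : ∀ {f t} → m * t ≤ 2 * n → Linked f t 0 → ∀ j → j ≤ t → Σ (Fin n → Label) λ f′ → Linked f′ t j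
      link-all size S zero    _   = _ , S
      link-all size S (suc j) j<t = link size j<t (proj₂ (link-all size S j (<⇒≤ j<t)))

  -- The blocks of a linked labelling

  -- Block numbers are written in base 4: the last digit is the place within the clique, the rest is
  -- the index of the clique.
  code-injective : ∀ a k b l → a < 4 → b < 4 → a + k * 4 ≡ b + l * 4 → a ≡ b × k ≡ l
  code-injective a k b l a<4 b<4 eq = a≡b , *-cancelʳ-≡ k l 4 (+-cancelˡ-≡ a _ _ (trans eq (cong (_+ l * 4) (sym a≡b))))
    where
    open ≡-Reasoning
    a≡b : a ≡ b
    a≡b = begin
      a                ≡⟨ sym (m<n⇒m%n≡m a<4) ⟩
      a % 4            ≡⟨ sym ([m+kn]%n≡m%n a k 4) ⟩
      (a + k * 4) % 4  ≡⟨ cong (_% 4) eq ⟩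
      (b + l * 4) % 4  ≡⟨ [m+kn]%n≡m%n b l 4 ⟩
      b % 4            ≡⟨ m<n⇒m%n≡m b<4 ⟩
      b ∎

  module _ {n : ℕ} (G : Graph n) (r c n′ t : ℕ) {f : Fin n → Label} (built : Built G r c n′ f t)
           (connected : ∀ {l} → l < t → Connected G r f t l) (con< : ∀ {l v} → f v ≡ con l → l < t)
           (noRaw : ∀ v → isRaw (f v) ≡ false) where

    open Built built

    JoinedTo : ℕ → Fin n → Set
    JoinedTo l v = ∀ u → f u ≡ con l → adj G u v ≡ true

    abstract
      joinedTo? : ∀ l v → Dec (JoinedTo l v)
      joinedTo? l v = Fin.all? λ u → con? l (f u) →-dec (adj G u v Bool.≟ true)

    -- The second index is the place of the block within clique k, in the cyclic order con, inn, mid, out.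
    data InBlock (v : Fin n) (k : ℕ) : ℕ → Set where
      in-con : f v ≡ con k → InBlock v k 0
      in-inn : home (f v) ≡ just k → JoinedTo k v → InBlock v k 1
      in-mid : home (f v) ≡ just k → InBlock v k 2
      in-out : home (f v) ≡ just k → JoinedTo (next t k) v → InBlock v k 3

    -- An `inn` or `out` vertex goes next to the connector only if it is joined to all of it.
    -- Otherwise it goes to the middle block, where membership in the clique suffices. The last
    -- clause serves `free` and `mid`; for `dead` and `raw` it is a default.
    position : Label → Fin n → ℕ
    position (con k)  v = 0
    position (inn k)  v = if does (joinedTo? k v) then 1 else 2
    position (out k)  v = if does (joinedTo? (next t k) v) then 3 else 2
    position _        v = 2

    item : Label → ℕ
    item (free k) = k
    item (inn k)  = k
    item (mid k)  = k
    item (out k)  = k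
    item (con k)  = k
    item _        = 0

    inBlock : ∀ v → f v ≢ dead → InBlock v (item (f v)) (position (f v) v)
    inBlock v alive with f v in eq
    ... | dead   = contradiction refl alive
    ... | raw    = case trans (sym (cong isRaw eq)) (noRaw v) of λ ()
    ... | free k = in-mid (cong home eq)
    ... | mid k  = in-mid (cong home eq)
    ... | con k  = in-con eq
    ... | inn k with joinedTo? k v
    ...   | yes j = in-inn (cong home eq) j
    ...   | no  _ = in-mid (cong home eq)
    inBlock v alive | out k with joinedTo? (next t k) v
    ...   | yes j = in-out (cong home eq) j
    ...   | no  _ = in-mid (cong home eq)

    inBlock-item< : ∀ {v k a} → InBlock v k a → k < t
    inBlock-item< (in-con eq)   = con< eq
    inBlock-item< (in-inn hv _) = bound hv
    inBlock-item< (in-mid hv)   = bound hv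
    inBlock-item< (in-out hv _) = bound hv

    inBlock-position< : ∀ {v k a} → InBlock v k a → a < 4
    inBlock-position< (in-con _)   = s≤s z≤n
    inBlock-position< (in-inn _ _) = s≤s (s≤s z≤n)
    inBlock-position< (in-mid _)   = s≤s (s≤s (s≤s z≤n))
    inBlock-position< (in-out _ _) = ≤-refl

    block : Fin n → ℕ
    block v = position (f v) v + item (f v) * 4

    same-block : ∀ {u v k a} → u ≢ v → InBlock u k a → InBlock v k a → adj G u v ≡ true
    same-block u≢v (in-con fu)   (in-con fv)   = Connected.clique (connected (con< fu)) u≢v fu fv
    same-block u≢v (in-inn hu _) (in-inn hv _) = clq u≢v hu hv
    same-block u≢v (in-mid hu)   (in-mid hv)   = clq u≢v hu hv
    same-block u≢v (in-out hu _) (in-out hv _) = clq u≢v hu hv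

    next-block : ∀ {u v k a} → u ≢ v → InBlock u k a → InBlock v k (suc a) → adj G u v ≡ true
    next-block u≢v (in-con fu)   (in-inn _ jv) = jv _ fu
    next-block u≢v (in-inn hu _) (in-mid hv)   = clq u≢v hu hv
    next-block u≢v (in-mid hu)   (in-out hv _) = clq u≢v hu hv

    next-item : ∀ {u v k l} → next t k ≡ l → InBlock u k 3 → InBlock v l 0 → adj G u v ≡ true
    next-item refl (in-out _ ju) (in-con fv) = trans (adj-sym G _ _) (ju _ fv)

    suc-block : ∀ {u v k l a b} → u ≢ v → InBlock u k a → InBlock v l b → suc (a + k * 4) ≡ b + l * 4 →
                adj G u v ≡ true
    -- The successor of 3 + 4k carries to 0 + 4(k + 1), so `v` is in the connector of clique k + 1;
    -- since k + 1 < t, `next` does not wrap.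
    suc-block {k = k} {l} {b = b} u≢v iu@(in-out _ _) iv eq
      with code-injective 0 (suc k) b l (s≤s z≤n) (inBlock-position< iv) eq
    ... | refl , refl = next-item (next-suc (<⇒≢ (inBlock-item< iv))) iu iv
    suc-block {k = k} {l} {b = b} u≢v iu@(in-con _)   iv eq with code-injective 1 k b l (s≤s (s≤s z≤n)) (inBlock-position< iv) eq
    ... | refl , refl = next-block u≢v iu iv
    suc-block {k = k} {l} {b = b} u≢v iu@(in-inn _ _) iv eq with code-injective 2 k b l (s≤s (s≤s (s≤s z≤n))) (inBlock-position< iv) eq
    ... | refl , refl = next-block u≢v iu iv
    suc-block {k = k} {l} {b = b} u≢v iu@(in-mid _)   iv eq with code-injective 3 k b l ≤-refl (inBlock-position< iv) eq
    ... | refl , refl = next-block u≢v iu iv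

    wrap-block : ∀ {u v k l a b} → InBlock u k a → InBlock v l b → suc (a + k * 4) ≡ t * 4 → b + l * 4 ≡ 0 →
                 adj G u v ≡ true
    wrap-block {k = k} {l} {b = b} iu@(in-out _ _) iv eq eq₀
      with code-injective b l 0 0 (inBlock-position< iv) (s≤s z≤n) eq₀
         | code-injective 0 (suc k) 0 t (s≤s z≤n) (s≤s z≤n) eq
    ... | refl , refl | _ , last = next-item (next-last last) iu iv
    -- The number before 4t has last digit 3, so only an exit block can be the last one.
    wrap-block {k = k} (in-con _)   iv eq _ = case proj₁ (code-injective 1 k 0 t (s≤s (s≤s z≤n)) (s≤s z≤n) eq) of λ ()
    wrap-block {k = k} (in-inn _ _) iv eq _ = case proj₁ (code-injective 2 k 0 t (s≤s (s≤s (s≤s z≤n))) (s≤s z≤n) eq) of λ ()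
    wrap-block {k = k} (in-mid _)   iv eq _ = case proj₁ (code-injective 3 k 0 t ≤-refl (s≤s z≤n) eq) of λ ()

    consecutive-adjacent : ∀ {u v} → f u ≢ dead → f v ≢ dead → u ≢ v → Consecutive (t * 4) (block u) (block v) →
                           adj G u v ≡ true
    consecutive-adjacent {u} {v} au av u≢v (inj₁ eq)
      with code-injective (position (f u) u) (item (f u)) (position (f v) v) (item (f v))
             (inBlock-position< (inBlock u au)) (inBlock-position< (inBlock v av)) eq
    ... | a≡ , k≡ = same-block u≢v (inBlock u au) (subst₂ (InBlock v) (sym k≡) (sym a≡) (inBlock v av))
    consecutive-adjacent {u} {v} au av u≢v (inj₂ (inj₁ eq)) = suc-block u≢v (inBlock u au) (inBlock v av) eq
    consecutive-adjacent {u} {v} au av u≢v (inj₂ (inj₂ (eq , eq₀))) = wrap-block (inBlock u au) (inBlock v av) eq eq₀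

    Full : ℕ → Set
    Full b = Σ (List (Fin n)) λ B → Unique B × r ≤ length B × All (λ v → f v ≢ dead × block v ≡ b) B

    full : ∀ {k ℓ} a → ℓ ≢ dead → item ℓ ≡ k → (B : List (Fin n)) → Unique B → r ≤ length B →
           All (λ v → f v ≡ ℓ × position ℓ v ≡ a) B → Full (a + k * 4)
    full a ℓ≢ refl B u r≤ all = B , u , r≤ , All.map (λ { {v} (refl , p≡) → ℓ≢ , cong (_+ item (f v) * 4) p≡ }) all

    full-block : ∀ {a k} → a < 4 → k < t → Full (a + k * 4)
    full-block {0} {k} _ k<t with Connected.connector (connected k<t)
    ... | B , len , u , all = full {ℓ = con k} 0 (λ ()) refl B u (≤-reflexive (sym len)) (All.map (_, refl) all)
    full-block {1} {k} _ k<t with Connected.entry (connected k<t)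
    ... | B , r≤ , u , all , att = full {ℓ = inn k} 1 (λ ()) refl B u r≤ (All.tabulate λ {v} v∈ →
            All.lookup all v∈ , cong (if_then 1 else 2) (dec-true (joinedTo? k v) (λ _ fu → att fu v∈)))
    full-block {2} {k} _ k<t with mids k<t
    ... | B , len , u , all = full {ℓ = mid k} 2 (λ ()) refl B u (≤-reflexive (sym len)) (All.map (_, refl) all)
    -- The vertices leaving clique k are found at the following connector, whose `exit` lies in
    -- clique `previous t (next t k)`, that is k.
    full-block {3} {k} _ k<t with Connected.exit (connected (next-< k<t))
    ... | B , r≤ , u , all , att = full {ℓ = out k} 3 (λ ()) refl B u r≤ (All.tabulate λ {v} v∈ →
            trans (All.lookup all v∈) (cong out (previous-next t k)) ,
            cong (if_then 3 else 2) (dec-true (joinedTo? (next t k) v) (λ _ fu → att fu v∈)))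
    full-block {suc (suc (suc (suc _)))} (s≤s (s≤s (s≤s (s≤s ())))) _

    linked⇒cyclePower : n′ ≤ n → r < n′ → HasCyclePower G r n′
    linked⇒cyclePower n′≤n r<n′ = cyclePower-from-blocks G r n′ (t * 4) r<n′
      (initialSegment n′≤n) (initialSegment-unique n′≤n) (length-initialSegment n′≤n) block
      (λ {v} v∈ → block< v (alive v∈))
      (λ {b} b<T → let (B , u , r≤ , all) = full-at b<T in
        B , u , r≤ , All.map (λ { (av , b≡) → live av , b≡ }) all)
      (λ u∈ v∈ → consecutive-adjacent (alive u∈) (alive v∈))
      where
      alive : ∀ {v} → v ∈ initialSegment n′≤n → f v ≢ dead
      alive v∈ fv = <⇒≱ (∈-initialSegment⁻ n′≤n v∈) (dead⇒ fv)
      live : ∀ {v} → f v ≢ dead → v ∈ initialSegment n′≤n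
      live {v} av = ∈-initialSegment⁺ n′≤n (≰⇒> λ le → av (dead⇐ le))
      block< : ∀ v → f v ≢ dead → block v < t * 4
      block< v av = ≤-trans (+-monoˡ-≤ (item (f v) * 4) (inBlock-position< (inBlock v av)))
                            (*-monoˡ-≤ 4 (inBlock-item< (inBlock v av)))
      full-at : ∀ {b} → b < t * 4 → Full b
      full-at {b} b<T = subst Full (sym (m≡m%n+[m/n]*n b 4))
        (full-block {b % 4} {b / 4} (m%n<n b 4) (m<n*o⇒m/o<n {b} {t} {4} b<T))

-- From the rational to the integral hypotheses

open import Data.Integer using (+_)
open import Data.Rational using (_<_; _≤_; _+_; _*_; _-_)

toℚᵘ-ℕ→ℚ : ∀ n → toℚᵘ (ℕ→ℚ n) ≃ᵘ mkℚᵘ (+ n) 0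
toℚᵘ-ℕ→ℚ n = ℚ.toℚᵘ-fromℚᵘ (mkℚᵘ (+ n) 0)

ℕ→ℚ-* : ∀ a b → ℕ→ℚ (a ℕ.* b) ≡ ℕ→ℚ a * ℕ→ℚ b
ℕ→ℚ-* a b = ℚ.toℚᵘ-injective (begin-equality
  toℚᵘ (ℕ→ℚ (a ℕ.* b))                 ≃⟨ toℚᵘ-ℕ→ℚ (a ℕ.* b) ⟩
  mkℚᵘ (+ (a ℕ.* b)) 0                  ≃⟨ *≡* (cong (ℤ._* + 1) (ℤ.pos-* a b)) ⟩
  mkℚᵘ (+ a) 0 ℚᵘ.* mkℚᵘ (+ b) 0        ≃⟨ ℚᵘ.*-cong (toℚᵘ-ℕ→ℚ a) (toℚᵘ-ℕ→ℚ b) ⟨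
  toℚᵘ (ℕ→ℚ a) ℚᵘ.* toℚᵘ (ℕ→ℚ b)        ≃⟨ ℚ.toℚᵘ-homo-* (ℕ→ℚ a) (ℕ→ℚ b) ⟨
  toℚᵘ (ℕ→ℚ a * ℕ→ℚ b) ∎)
  where open ℚᵘ.≤-Reasoning

ℕ→ℚ-+ : ∀ a b → ℕ→ℚ (a ℕ.+ b) ≡ ℕ→ℚ a + ℕ→ℚ b
ℕ→ℚ-+ a b = ℚ.toℚᵘ-injective (begin-equality
  toℚᵘ (ℕ→ℚ (a ℕ.+ b))                 ≃⟨ toℚᵘ-ℕ→ℚ (a ℕ.+ b) ⟩
  mkℚᵘ (+ (a ℕ.+ b)) 0                  ≃⟨ *≡* (cong (ℤ._* + 1) (cong₂ ℤ._+_ (sym (ℤ.*-identityʳ (+ a))) (sym (ℤ.*-identityʳ (+ b))))) ⟩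
  mkℚᵘ (+ a) 0 ℚᵘ.+ mkℚᵘ (+ b) 0        ≃⟨ ℚᵘ.+-cong (toℚᵘ-ℕ→ℚ a) (toℚᵘ-ℕ→ℚ b) ⟨
  toℚᵘ (ℕ→ℚ a) ℚᵘ.+ toℚᵘ (ℕ→ℚ b)        ≃⟨ ℚ.toℚᵘ-homo-+ (ℕ→ℚ a) (ℕ→ℚ b) ⟨
  toℚᵘ (ℕ→ℚ a + ℕ→ℚ b) ∎)
  where open ℚᵘ.≤-Reasoning

ℕ→ℚ-cancel-≤ : ∀ {a b} → ℕ→ℚ a ≤ ℕ→ℚ b → a ℕ.≤ b
ℕ→ℚ-cancel-≤ {a} {b} le = ℤ.drop‿+≤+ (subst₂ ℤ._≤_ (ℤ.*-identityʳ (+ a)) (ℤ.*-identityʳ (+ b))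
  (ℚᵘ.drop-*≤* (ℚᵘ.≤-respˡ-≃ (toℚᵘ-ℕ→ℚ a) (ℚᵘ.≤-respʳ-≃ (toℚᵘ-ℕ→ℚ b) (ℚ.toℚᵘ-mono-≤ le)))))

ℕ→ℚ-mono-≤ : ∀ {a b} → a ℕ.≤ b → ℕ→ℚ a ≤ ℕ→ℚ b
ℕ→ℚ-mono-≤ {a} {b} le = ℚ.toℚᵘ-cancel-≤ (ℚᵘ.≤-respˡ-≃ (ℚᵘ.≃-sym (toℚᵘ-ℕ→ℚ a)) (ℚᵘ.≤-respʳ-≃ (ℚᵘ.≃-sym (toℚᵘ-ℕ→ℚ b))
  (*≤* (ℤ.*-monoʳ-≤-nonNeg (+ 1) (ℤ.+≤+ le)))))

*-monoˡ-≤-ℕ→ℚ : ∀ k {p q} → p ≤ q → ℕ→ℚ k * p ≤ ℕ→ℚ k * q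
*-monoˡ-≤-ℕ→ℚ k = ℚ.*-monoˡ-≤-nonNeg (ℕ→ℚ k) {{ℚ.normalize-nonNeg k 1}}

*-monoʳ-≤-ℕ→ℚ : ∀ k {p q} → p ≤ q → p * ℕ→ℚ k ≤ q * ℕ→ℚ k
*-monoʳ-≤-ℕ→ℚ k = ℚ.*-monoʳ-≤-nonNeg (ℕ→ℚ k) {{ℚ.normalize-nonNeg k 1}}

ℕ→ℚ-pos : ∀ n .{{_ : NonZero n}} → Positive (ℕ→ℚ n)
ℕ→ℚ-pos n = ℚ.normalize-pos n 1

-- The denominator of x serves as q, since a positive numerator is at least 1.
archimedean : ∀ {x} → 0ℚ < x → Σ ℕ λ q → NonZero q × (∀ {k} → q ℕ.≤ k → 1ℚ ≤ ℕ→ℚ k * x)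
archimedean {x@(mkℚ (+ 0) _ _)} 0<x with () ← ℚ.positive 0<x
archimedean {x@(mkℚ (ℤ.-[1+ _ ]) _ _)} 0<x with () ← ℚ.positive 0<x
archimedean {x@(mkℚ (+ suc p) q-1 _)} 0<x = suc q-1 , _ , λ {k} q≤k → begin
  1ℚ                 ≤⟨ ℕ→ℚ-mono-≤ {1} {suc p} (s≤s z≤n) ⟩
  ℕ→ℚ (suc p)        ≡⟨ sym numerator ⟩
  ℕ→ℚ (suc q-1) * x  ≤⟨ ℚ.*-monoʳ-≤-nonNeg x (ℕ→ℚ-mono-≤ q≤k) ⟩
  ℕ→ℚ k * x ∎
  where
  open ℚ.≤-Reasoning
  numerator : ℕ→ℚ (suc q-1) * x ≡ ℕ→ℚ (suc p)
  numerator = ℚ.toℚᵘ-injective (ℚᵘ.≃-trans (ℚ.toℚᵘ-homo-* (ℕ→ℚ (suc q-1)) x)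
    (ℚᵘ.≃-trans (ℚᵘ.*-congʳ {toℚᵘ x} (toℚᵘ-ℕ→ℚ (suc q-1)))
    (ℚᵘ.≃-trans (*≡* (trans (ℤ.*-identityʳ _) (trans (ℤ.*-comm (+ suc q-1) (+ suc p))
                   (cong (+ suc p ℤ.*_) (sym (ℤ.*-identityˡ (+ suc q-1)))))))
    (ℚᵘ.≃-sym (toℚᵘ-ℕ→ℚ (suc p))))))

-- Multiply the density inequality by DP: the error becomes exactly n², and Dd ≥ 1 replaces d by
-- 1/D.
dense⇒locallyDense : ∀ {n} (G : Graph n) {ρ d} D P → 1ℚ ≤ ℕ→ℚ D * d → ℕ→ℚ (D ℕ.* P) * ρ ≡ 1ℚ →
  Dense ρ d G → LocallyDense D P G
dense⇒locallyDense {n} G {ρ} {d} D P 1≤Dd ρ≡ dense X = ℕ→ℚ-cancel-≤ (begin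
  ℕ→ℚ (P ℕ.* k)                             ≡⟨ sym (ℚ.*-identityˡ _) ⟩
  1ℚ * ℕ→ℚ (P ℕ.* k)                        ≤⟨ *-monoʳ-≤-ℕ→ℚ (P ℕ.* k) 1≤Dd ⟩
  (ℕ→ℚ D * d) * ℕ→ℚ (P ℕ.* k)               ≡⟨ cong (ℕ→ℚ D * d *_) (ℕ→ℚ-* P k) ⟩
  (ℕ→ℚ D * d) * (ℕ→ℚ P * ℕ→ℚ k)             ≡⟨ s₁ (ℕ→ℚ D) d (ℕ→ℚ P) (ℕ→ℚ k) (ρ * N) ⟩
  (ℕ→ℚ D * ℕ→ℚ P) * (d * ℕ→ℚ k - ρ * N) + (ℕ→ℚ D * ℕ→ℚ P) * (ρ * N)
                                            ≡⟨ cong (λ z → z * (d * ℕ→ℚ k - ρ * N) + z * (ρ * N)) (sym (ℕ→ℚ-* D P)) ⟩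
  DP * (d * ℕ→ℚ k - ρ * N) + DP * (ρ * N)   ≤⟨ ℚ.+-mono-≤ (*-monoˡ-≤-ℕ→ℚ (D ℕ.* P) dense′) (ℚ.≤-reflexive ρN) ⟩
  DP * ℕ→ℚ (eIn G X) + N                    ≡⟨ cong (_+ N) (sym (ℕ→ℚ-* (D ℕ.* P) (eIn G X))) ⟩
  ℕ→ℚ (D ℕ.* P ℕ.* eIn G X) + N             ≡⟨ sym (ℕ→ℚ-+ (D ℕ.* P ℕ.* eIn G X) (n ℕ.* n)) ⟩
  ℕ→ℚ (D ℕ.* P ℕ.* eIn G X ℕ.+ n ℕ.* n) ∎)
  where
  open ℚ.≤-Reasoning
  k = card X C 2
  N = ℕ→ℚ (n ℕ.* n)
  DP = ℕ→ℚ (D ℕ.* P)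
  dense′ : d * ℕ→ℚ k - ρ * N ≤ ℕ→ℚ (eIn G X)
  dense′ = subst (λ x → d * ℕ→ℚ (x C 2) - ρ * N ≤ ℕ→ℚ (eIn G X)) (count≡card X) (dense X)
  ρN : DP * (ρ * N) ≡ N
  ρN = trans (sym (ℚ.*-assoc DP ρ N)) (trans (cong (_* N) ρ≡) (ℚ.*-identityˡ N))
  s₁ : ∀ D d P k y → (D * d) * (P * k) ≡ (D * P) * (d * k - y) + (D * P) * y
  s₁ = solve 5 (λ D d P k y → (D :* d) :* (P :* k) := (D :* P) :* (d :* k :- y) :+ (D :* P) :* y) refl
    where open +-*-Solver

-- The conclusion is degree at least (1/2 + 1/h)n, multiplied by 2h.
minDeg⇒deg : ∀ {n} (G : Graph n) {η} h → 1ℚ ≤ ℕ→ℚ h * η → minDeg≥ G (½ + η) →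
  ∀ v → (2 ℕ.+ h) ℕ.* n ℕ.≤ 2 ℕ.* h ℕ.* card (adj G v)
minDeg⇒deg {n} G {η} h 1≤hη deg≥ v = ℕ→ℚ-cancel-≤ (begin
  ℕ→ℚ ((2 ℕ.+ h) ℕ.* n)                           ≡⟨ trans (ℕ→ℚ-* (2 ℕ.+ h) n) (cong (_* ℕ→ℚ n) (ℕ→ℚ-+ 2 h)) ⟩
  (ℕ→ℚ 2 + ℕ→ℚ h) * ℕ→ℚ n                         ≡⟨ cong (λ z → (z + ℕ→ℚ h) * ℕ→ℚ n) (sym (ℚ.*-identityʳ (ℕ→ℚ 2))) ⟩
  (ℕ→ℚ 2 * 1ℚ + ℕ→ℚ h) * ℕ→ℚ n                    ≤⟨ *-monoʳ-≤-ℕ→ℚ n (ℚ.+-monoˡ-≤ (ℕ→ℚ h) (*-monoˡ-≤-ℕ→ℚ 2 1≤hη)) ⟩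
  (ℕ→ℚ 2 * (ℕ→ℚ h * η) + ℕ→ℚ h) * ℕ→ℚ n           ≡⟨ cong (λ z → (ℕ→ℚ 2 * (ℕ→ℚ h * η) + z) * ℕ→ℚ n) (sym (ℚ.*-identityˡ (ℕ→ℚ h))) ⟩
  (ℕ→ℚ 2 * (ℕ→ℚ h * η) + (ℕ→ℚ 2 * ½) * ℕ→ℚ h) * ℕ→ℚ n
                                                  ≡⟨ s₁ (ℕ→ℚ 2) (ℕ→ℚ h) η ½ (ℕ→ℚ n) ⟩
  (ℕ→ℚ 2 * ℕ→ℚ h) * ((½ + η) * ℕ→ℚ n)             ≡⟨ cong (_* ((½ + η) * ℕ→ℚ n)) (sym (ℕ→ℚ-* 2 h)) ⟩
  ℕ→ℚ (2 ℕ.* h) * ((½ + η) * ℕ→ℚ n)               ≤⟨ *-monoˡ-≤-ℕ→ℚ (2 ℕ.* h) (deg≥ v) ⟩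
  ℕ→ℚ (2 ℕ.* h) * ℕ→ℚ (deg G v)                   ≡⟨ sym (ℕ→ℚ-* (2 ℕ.* h) (deg G v)) ⟩
  ℕ→ℚ (2 ℕ.* h ℕ.* deg G v)                       ≡⟨ cong (λ x → ℕ→ℚ (2 ℕ.* h ℕ.* x)) (count≡card (adj G v)) ⟩
  ℕ→ℚ (2 ℕ.* h ℕ.* card (adj G v)) ∎)
  where
  open ℚ.≤-Reasoning
  s₁ : ∀ t h e b n → (t * (h * e) + (t * b) * h) * n ≡ (t * h) * ((b + e) * n)
  s₁ = solve 5 (λ t h e b n → (t :* (h :* e) :+ (t :* b) :* h) :* n := (t :* h) :* ((b :+ e) :* n)) refl
    where open +-*-Solver

-- Assembly and choice of constants

cliqueRich⇒cyclePower : ∀ {n} (G : Graph n) r h s E .{{_ : NonZero r}} .{{_ : NonZero h}} → 2 ℕ.≤ h →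
  let open Parameters r h ; m = 8 ℕ.* h ℕ.* K in
  CliqueRich E m G → m ℕ.≤ E → 4 ℕ.≤ E → 2 ℕ.* h ℕ.* 2 ℕ.^ (c ℕ.+ c) ℕ.≤ E →
  (∀ x → (2 ℕ.+ h) ℕ.* n ℕ.≤ 2 ℕ.* h ℕ.* card (adj G x)) → 4 ℕ.* h ℕ.* s ℕ.≤ n →
  ∀ n′ → n′ ℕ.≤ n → n ℕ.≤ n′ ℕ.+ s → r ℕ.< n′ → HasCyclePower G r n′
cliqueRich⇒cyclePower {n} G r h s E 2≤h = main _ refl
  where
  open Parameters r h
  main : ∀ m → m ≡ 8 ℕ.* h ℕ.* K → CliqueRich E m G → m ℕ.≤ E → 4 ℕ.≤ E → 2 ℕ.* h ℕ.* 2 ℕ.^ (c ℕ.+ c) ℕ.≤ E →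
    (∀ x → (2 ℕ.+ h) ℕ.* n ℕ.≤ 2 ℕ.* h ℕ.* card (adj G x)) → 4 ℕ.* h ℕ.* s ℕ.≤ n →
    ∀ n′ → n′ ℕ.≤ n → n ℕ.≤ n′ ℕ.+ s → r ℕ.< n′ → HasCyclePower G r n′
  main m m≡ cl m≤E 4≤E E≥ deg s≤ n′ n′≤n n≤ r<n′ =
    let (f , t , S , noRaw , size) = Partition.partition G r h s n′ E m 2≤h m≡ cl m≤E 4≤E deg s≤ n′≤n n≤
        open Stage S
        start = record
          { built  = built
          ; done   = λ ()
          ; fresh  = λ _ → noCon
          ; noRaw  = noRaw
          ; fixed≤ = ℕ.≤-trans fixed≤ (ℕ.m≤m+n _ _)
          }
        (f′ , L) = Link.link-all G r h s n′ E m m≡ cl E≥ deg s≤ size start t ℕ.≤-refl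
    in linked⇒cyclePower G r c n′ t (Linked.built L) (Linked.done L)
         (λ {l} {v} eq → ℕ.≰⇒> λ le → Linked.fresh L le eq) (Linked.noRaw L) n′≤n r<n′

HasCyclePower-≤ : ∀ {n} {G : Graph n} {r r′ k} → r ℕ.≤ r′ → HasCyclePower G r′ k → HasCyclePower G r k
HasCyclePower-≤ r≤ (w , inj , edge) = w , inj , λ i l j 1≤j j≤r → edge i l j 1≤j (ℕ.≤-trans j≤r r≤)

theorem12 : (r s : ℕ) (d η : ℚ) → 0ℚ < d → 0ℚ < η →
    Σ ℚ λ ρ → Σ ℕ λ n₀ → 0ℚ < ρ × 0 ℕ.< n₀ ×
    (∀ (n : ℕ) (G : Graph n) → n₀ ℕ.≤ n → Dense ρ d G → minDeg≥ G (½ + η) →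
    HasHamCyclePower G r ×
    (∀ (n' : ℕ) → n ℕ.≤ n' ℕ.+ s → n' ℕ.≤ n → HasCyclePower G r n'))
theorem12 r₀ s d η 0<d 0<η with archimedean 0<d | archimedean 0<η
... | D , D≢0 , 1≤Dd | q , q≢0 , 1≤qη =
  ρ , n₀ , ρ>0 , s≤s z≤n , λ n G n₀≤n dense deg≥ →
    let powers = all-powers n G n₀≤n dense deg≥ in powers n (ℕ.m≤m+n n s) ℕ.≤-refl , powers
  where
  -- Raising the power by one makes the connecting cliques nonempty.
  r = suc r₀
  -- Already qη ≥ 1; the successor secures h ≥ 2.
  h = suc q
  open Parameters r h
  -- The summands of `E` answer its three uses: n/m raw vertices in the greedy stage, n/4 free
  -- neighbours of a left-over vertex, and the homogeneous set of a connection. `F` is the loss over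
  -- m rounds of clique building, and `P` makes the density error harmless for sets of n/F vertices.
  -- In `n₀`, 5F excludes tiny sets, 4hs pays for the dead vertices, and r + s with the successor
  -- gives r < n'.
  m E F P n₀ : ℕ
  m  = 8 ℕ.* h ℕ.* K
  E  = m ℕ.+ 4 ℕ.+ 2 ℕ.* h ℕ.* 2 ℕ.^ (c ℕ.+ c)
  F  = E ℕ.* (4 ℕ.* D) ℕ.^ m
  P  = 8 ℕ.* (F ℕ.* F)
  n₀ = suc (5 ℕ.* F ℕ.+ 4 ℕ.* h ℕ.* s ℕ.+ (r ℕ.+ s))

  4≤E : 4 ℕ.≤ E
  4≤E = ℕ.≤-trans (ℕ.m≤n+m 4 m) (ℕ.m≤m+n (m ℕ.+ 4) _)
  m≤E : m ℕ.≤ E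
  m≤E = ℕ.≤-trans (ℕ.m≤m+n m 4) (ℕ.m≤m+n (m ℕ.+ 4) _)

  instance
    _ = D≢0
    E≢0 : NonZero E
    E≢0 = ℕ.>-nonZero (ℕ.≤-trans (s≤s z≤n) 4≤E)
    4D≢0 : NonZero (4 ℕ.* D)
    4D≢0 = ℕ.m*n≢0 4 D
    pow≢0 : NonZero ((4 ℕ.* D) ℕ.^ m)
    pow≢0 = ℕ.m^n≢0 (4 ℕ.* D) m
    F≢0 : NonZero F
    F≢0 = ℕ.m*n≢0 E ((4 ℕ.* D) ℕ.^ m)
    FF≢0 : NonZero (F ℕ.* F)
    FF≢0 = ℕ.m*n≢0 F F
    P≢0 : NonZero P
    P≢0 = ℕ.m*n≢0 8 (F ℕ.* F)
    DP≢0 : NonZero (D ℕ.* P)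
    DP≢0 = ℕ.m*n≢0 D P
    DP-pos : Positive (ℕ→ℚ (D ℕ.* P))
    DP-pos = ℕ→ℚ-pos (D ℕ.* P)
    DP-nonZero : ℚ.NonZero (ℕ→ℚ (D ℕ.* P))
    DP-nonZero = ℚ.pos⇒nonZero (ℕ→ℚ (D ℕ.* P))

  ρ : ℚ
  ρ = 1/ ℕ→ℚ (D ℕ.* P)
  ρ>0 : 0ℚ < ρ
  ρ>0 = ℚ.positive⁻¹ ρ {{ℚ.1/pos⇒pos (ℕ→ℚ (D ℕ.* P))}}

  all-powers : ∀ n (G : Graph n) → n₀ ℕ.≤ n → Dense ρ d G → minDeg≥ G (½ + η) →
    ∀ n' → n ℕ.≤ n' ℕ.+ s → n' ℕ.≤ n → HasCyclePower G r₀ n'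
  all-powers n G n₀≤n dense deg≥ n' n≤ n'≤n = HasCyclePower-≤ {G = G} (ℕ.n≤1+n r₀)
    (cliqueRich⇒cyclePower G r h s E (s≤s (ℕ.>-nonZero⁻¹ q {{q≢0}}))
      (locallyDense⇒cliqueRich G D E m
        (dense⇒locallyDense G D P (1≤Dd ℕ.≤-refl) (ℚ.*-inverseʳ (ℕ→ℚ (D ℕ.* P))) dense)
        (ℕ.≤-trans (ℕ.m≤m+n (5 ℕ.* F) _) (ℕ.≤-trans (ℕ.m≤m+n _ (r ℕ.+ s)) (ℕ.<⇒≤ n₀≤n))))
      m≤E 4≤E (ℕ.m≤n+m _ (m ℕ.+ 4))
      (minDeg⇒deg G h (1≤qη (ℕ.n≤1+n q)) deg≥)
      (ℕ.≤-trans (ℕ.m≤n+m _ (5 ℕ.* F)) (ℕ.≤-trans (ℕ.m≤m+n _ (r ℕ.+ s)) (ℕ.<⇒≤ n₀≤n)))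
      n' n'≤n n≤
      (ℕ.+-cancelʳ-< s r n' (ℕ.≤-trans (s≤s (ℕ.m≤n+m (r ℕ.+ s) (5 ℕ.* F ℕ.+ 4 ℕ.* h ℕ.* s))) (ℕ.≤-trans n₀≤n n≤))))
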